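{- For every integer $n\geq 1$, $$F_{n}(y,t)=\frac{1}{1+t}\left(\frac{(1+y)^{n}}{t}A_{n}(t^{2})+\sum_{k=0}^{n}\binom{n}{k}(1+y)^{k}(1-t^{2})^{n-k}A_{k}(t^{2})\right).$$
   Context: $\mathfrak{S}_n$ is the set of permutations $\pi=\pi_1\cdots\pi_n$ of $[n]=\{1,\dots,n\}$, $\mathrm{des}(\pi)$ is the number of $i\in[n-1]$ with $\pi_i>\pi_{i+1}$, and the Eulerian polynomials are $A_n(t)=\sum_{\pi\in\mathfrak{S}_n}t^{\mathrm{des}(\pi)+1}$ for $n\ge1$ and $A_0(t)=1$. $\mathfrak{B}_n$ is the set of signed permutations: permutations $\pi$ of $\{ -n,\dots,-1,0,1,\dots,n\}$ with $\pi_{ -i}=-\pi_i$ for all $i$ (so $\pi_0=0$), written $\pi=\pi_1\cdots\pi_n$. For $\pi\in\mathfrak{B}_n$: $\mathrm{des}_B(\pi)$ is the number of $i\in\{0,1,\dots,n-1\}$ with $\pi_i>\pi_{i+1}$ (where $\pi_0=0$); the flag descent number $\mathrm{fdes}(\pi)$ is $2\,\mathrm{des}_B(\pi)$ if $\pi_1>0$ and $2\,\mathrm{des}_B(\pi)-1$ if $\pi_1<0$; $\mathrm{neg}(\pi)$ is the number of $i\in[n]$ with $\pi_i<0$. $F_n(y,t)=\sum_{\pi\in\mathfrak{B}_n}y^{\mathrm{neg}(\pi)}t^{\mathrm{fdes}(\pi)}$ for $n\ge1$. The identity is one of rational functions in the indeterminates $y,t$. -}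

module Defs where

open import Algebra.Bundles using (CommutativeRing)
open import Algebra.Properties.Ring using (-‿distribˡ-*)
import Algebra.Properties.Semiring.Exp
import Algebra.Properties.Semiring.Mult
import Algebra.Properties.Semiring.Sum
import Algebra.Solver.Ring.NaturalCoefficients.Default
open import Data.Bool.Base using (if_then_else_)
open import Data.Fin.Base as Fin using (Fin; zero; suc; inject₁; opposite; _↑ʳ_)
open import Data.Fin.Properties as Fin using (all?; any?)
import Data.Integer.Properties as ℤ
open import Data.List.Base using (List; []; _∷_; allFin; cartesianProductWith; filter; foldr; length; map)
open import Data.Nat.Base as ℕ using (ℕ; zero; suc; _∸_; NonZero)
open import Data.Product.Base using (_×_; _,_; proj₁; proj₂)
open import Data.Sum.Base as Sum using (_⊎_; inj₁; inj₂)
open import Data.Vec.Base as Vec using (Vec; lookup)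
open import Function.Definitions using (Bijective; Injective; Surjective)
open import Level using (_⊔_; 0ℓ) renaming (suc to lsuc)
open import Relation.Binary.PropositionalEquality.Core as ≡ using (_≡_)
open import Relation.Nullary.Decidable using (Dec; does; map′; _×-dec_; _→-dec_)
open import Relation.Nullary.Negation using (¬_; contradiction)
open import Relation.Unary using (Decidable)
import Relation.Binary.Reasoning.Setoid

record IntegralDomain c ℓ : Set (lsuc (c ⊔ ℓ)) where
  field
    commutativeRing : CommutativeRing c ℓ
  open CommutativeRing commutativeRing public
  field
    1≉0           : ¬ 1# ≈ 0#
    noZeroDivisor : ∀ {x y} → x * y ≈ 0# → x ≈ 0# ⊎ y ≈ 0#

-- The list a₀ ∷ a₁ ∷ … is the polynomial a₀ + a₁X + …; trailing zeros are
-- allowed, so equality is equality of all coefficients.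

module Polynomial {c ℓ} (R : IntegralDomain c ℓ) where
  open IntegralDomain R
  open Algebra.Solver.Ring.NaturalCoefficients.Default commutativeSemiring
    using (solve; _:=_; _:+_)
  open Relation.Binary.Reasoning.Setoid setoid

  Poly : Set c
  Poly = List Carrier

  coeff : Poly → ℕ → Carrier
  coeff []      _       = 0#
  coeff (a ∷ p) zero    = a
  coeff (a ∷ p) (suc k) = coeff p k

  infix 4 _≋_
  record _≋_ (p q : Poly) : Set ℓ where
    constructor mk≋
    field at : ∀ k → coeff p k ≈ coeff q k
  open _≋_ public

  infixl 6 _+ₚ_
  infixl 7 _*ₚ_

  _+ₚ_ : Poly → Poly → Poly
  []      +ₚ q       = q
  (a ∷ p) +ₚ []      = a ∷ p
  (a ∷ p) +ₚ (b ∷ q) = (a + b) ∷ (p +ₚ q)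

  -ₚ_ : Poly → Poly
  -ₚ_ = map (-_)

  scale : Carrier → Poly → Poly
  scale a = map (a *_)

  _*ₚ_ : Poly → Poly → Poly
  []      *ₚ q = []
  (a ∷ p) *ₚ q = scale a q +ₚ (0# ∷ p *ₚ q)

  const : Carrier → Poly
  const a = a ∷ []

  X : Poly
  X = 0# ∷ 1# ∷ []

  private
    coeff-+ : ∀ p q k → coeff (p +ₚ q) k ≈ coeff p k + coeff q k
    coeff-+ []      q       k       = sym (+-identityˡ _)
    coeff-+ (a ∷ p) []      k       = sym (+-identityʳ _)
    coeff-+ (a ∷ p) (b ∷ q) zero    = refl
    coeff-+ (a ∷ p) (b ∷ q) (suc k) = coeff-+ p q k

    coeff-neg : ∀ p k → coeff (-ₚ p) k ≈ - coeff p k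
    coeff-neg []      k       = begin
      0#         ≈⟨ -‿inverseʳ 0# ⟨
      0# + - 0#  ≈⟨ +-identityˡ _ ⟩
      - 0#       ∎
    coeff-neg (a ∷ p) zero    = refl
    coeff-neg (a ∷ p) (suc k) = coeff-neg p k

    coeff-scale : ∀ a p k → coeff (scale a p) k ≈ a * coeff p k
    coeff-scale a []      k       = sym (zeroʳ a)
    coeff-scale a (b ∷ p) zero    = refl
    coeff-scale a (b ∷ p) (suc k) = coeff-scale a p k

    ≋-refl : ∀ {p} → p ≋ p
    ≋-refl = mk≋ λ _ → refl

    ≋-sym : ∀ {p q} → p ≋ q → q ≋ p
    ≋-sym e = mk≋ λ k → sym (at e k)

    ≋-trans : ∀ {p q r} → p ≋ q → q ≋ r → p ≋ r
    ≋-trans e f = mk≋ λ k → trans (at e k) (at f k)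

    cons : ∀ {a b p q} → a ≈ b → p ≋ q → (a ∷ p) ≋ (b ∷ q)
    cons a≈b e = mk≋ λ { zero → a≈b ; (suc k) → at e k }

    tail≋ : ∀ {a b p q} → (a ∷ p) ≋ (b ∷ q) → p ≋ q
    tail≋ e = mk≋ λ k → at e (suc k)

    tail≋[] : ∀ {a p} → (a ∷ p) ≋ [] → p ≋ []
    tail≋[] e = mk≋ λ k → at e (suc k)

    0∷≋[] : ∀ {a p} → a ≈ 0# → p ≋ [] → (a ∷ p) ≋ []
    0∷≋[] a≈0 e = mk≋ λ { zero → a≈0 ; (suc k) → at e k }

    +ₚ-cong : ∀ {p p′ q q′} → p ≋ p′ → q ≋ q′ → (p +ₚ q) ≋ (p′ +ₚ q′)
    +ₚ-cong {p} {p′} {q} {q′} e f = mk≋ λ k → begin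
      coeff (p +ₚ q) k       ≈⟨ coeff-+ p q k ⟩
      coeff p k + coeff q k  ≈⟨ +-cong (at e k) (at f k) ⟩
      coeff p′ k + coeff q′ k ≈⟨ coeff-+ p′ q′ k ⟨
      coeff (p′ +ₚ q′) k     ∎

    +ₚ-assoc : ∀ p q r → ((p +ₚ q) +ₚ r) ≋ (p +ₚ (q +ₚ r))
    +ₚ-assoc p q r = mk≋ λ k → begin
      coeff ((p +ₚ q) +ₚ r) k               ≈⟨ coeff-+ (p +ₚ q) r k ⟩
      coeff (p +ₚ q) k + coeff r k          ≈⟨ +-congʳ (coeff-+ p q k) ⟩
      (coeff p k + coeff q k) + coeff r k   ≈⟨ +-assoc _ _ _ ⟩
      coeff p k + (coeff q k + coeff r k)   ≈⟨ +-congˡ (coeff-+ q r k) ⟨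
      coeff p k + coeff (q +ₚ r) k          ≈⟨ coeff-+ p (q +ₚ r) k ⟨
      coeff (p +ₚ (q +ₚ r)) k               ∎

    +ₚ-comm : ∀ p q → (p +ₚ q) ≋ (q +ₚ p)
    +ₚ-comm p q = mk≋ λ k → begin
      coeff (p +ₚ q) k       ≈⟨ coeff-+ p q k ⟩
      coeff p k + coeff q k  ≈⟨ +-comm _ _ ⟩
      coeff q k + coeff p k  ≈⟨ coeff-+ q p k ⟨
      coeff (q +ₚ p) k       ∎

    +ₚ-identityʳ : ∀ p → (p +ₚ []) ≋ p
    +ₚ-identityʳ p = +ₚ-comm p []

    +ₚ-interchange : ∀ p q r s → ((p +ₚ q) +ₚ (r +ₚ s)) ≋ ((p +ₚ r) +ₚ (q +ₚ s))
    +ₚ-interchange p q r s = mk≋ λ k → begin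
      coeff ((p +ₚ q) +ₚ (r +ₚ s)) k
        ≈⟨ coeff-+ (p +ₚ q) (r +ₚ s) k ⟩
      coeff (p +ₚ q) k + coeff (r +ₚ s) k
        ≈⟨ +-cong (coeff-+ p q k) (coeff-+ r s k) ⟩
      (coeff p k + coeff q k) + (coeff r k + coeff s k)
        ≈⟨ solve 4 (λ a b c d → ((a :+ b) :+ (c :+ d)) := ((a :+ c) :+ (b :+ d))) refl _ _ _ _ ⟩
      (coeff p k + coeff r k) + (coeff q k + coeff s k)
        ≈⟨ +-cong (coeff-+ p r k) (coeff-+ q s k) ⟨
      coeff (p +ₚ r) k + coeff (q +ₚ s) k
        ≈⟨ coeff-+ (p +ₚ r) (q +ₚ s) k ⟨
      coeff ((p +ₚ r) +ₚ (q +ₚ s)) k ∎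

    -ₚ-inverseˡ : ∀ p → ((-ₚ p) +ₚ p) ≋ []
    -ₚ-inverseˡ p = mk≋ λ k → begin
      coeff ((-ₚ p) +ₚ p) k      ≈⟨ coeff-+ (-ₚ p) p k ⟩
      coeff (-ₚ p) k + coeff p k ≈⟨ +-congʳ (coeff-neg p k) ⟩
      - coeff p k + coeff p k    ≈⟨ -‿inverseˡ _ ⟩
      0#                         ∎

    -ₚ-inverseʳ : ∀ p → (p +ₚ (-ₚ p)) ≋ []
    -ₚ-inverseʳ p = ≋-trans (+ₚ-comm p (-ₚ p)) (-ₚ-inverseˡ p)

    -ₚ-cong : ∀ {p q} → p ≋ q → (-ₚ p) ≋ (-ₚ q)
    -ₚ-cong {p} {q} e = mk≋ λ k →
      trans (coeff-neg p k) (trans (-‿cong (at e k)) (sym (coeff-neg q k)))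

    scale-cong : ∀ {a b p q} → a ≈ b → p ≋ q → scale a p ≋ scale b q
    scale-cong {a} {b} {p} {q} a≈b e = mk≋ λ k →
      trans (coeff-scale a p k) (trans (*-cong a≈b (at e k)) (sym (coeff-scale b q k)))

    scale-zero : ∀ {a} p → a ≈ 0# → scale a p ≋ []
    scale-zero {a} p a≈0 = mk≋ λ k →
      trans (coeff-scale a p k) (trans (*-congʳ a≈0) (zeroˡ _))

    scale-+ₚ : ∀ a p q → scale a (p +ₚ q) ≋ (scale a p +ₚ scale a q)
    scale-+ₚ a p q = mk≋ λ k → begin
      coeff (scale a (p +ₚ q)) k                   ≈⟨ coeff-scale a (p +ₚ q) k ⟩
      a * coeff (p +ₚ q) k                         ≈⟨ *-congˡ (coeff-+ p q k) ⟩
      a * (coeff p k + coeff q k)                  ≈⟨ distribˡ a _ _ ⟩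
      a * coeff p k + a * coeff q k                ≈⟨ +-cong (coeff-scale a p k) (coeff-scale a q k) ⟨
      coeff (scale a p) k + coeff (scale a q) k    ≈⟨ coeff-+ (scale a p) (scale a q) k ⟨
      coeff (scale a p +ₚ scale a q) k             ∎

    scale-distribʳ : ∀ a b p → scale (a + b) p ≋ (scale a p +ₚ scale b p)
    scale-distribʳ a b p = mk≋ λ k → begin
      coeff (scale (a + b) p) k                    ≈⟨ coeff-scale (a + b) p k ⟩
      (a + b) * coeff p k                          ≈⟨ distribʳ _ a b ⟩
      a * coeff p k + b * coeff p k                ≈⟨ +-cong (coeff-scale a p k) (coeff-scale b p k) ⟨
      coeff (scale a p) k + coeff (scale b p) k    ≈⟨ coeff-+ (scale a p) (scale b p) k ⟨
      coeff (scale a p +ₚ scale b p) k             ∎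

    scale-scale : ∀ a b p → scale (a * b) p ≋ scale a (scale b p)
    scale-scale a b p = mk≋ λ k → begin
      coeff (scale (a * b) p) k      ≈⟨ coeff-scale (a * b) p k ⟩
      (a * b) * coeff p k            ≈⟨ *-assoc _ _ _ ⟩
      a * (b * coeff p k)            ≈⟨ *-congˡ (coeff-scale b p k) ⟨
      a * coeff (scale b p) k        ≈⟨ coeff-scale a (scale b p) k ⟨
      coeff (scale a (scale b p)) k  ∎

    scale-one : ∀ p → scale 1# p ≋ p
    scale-one p = mk≋ λ k → trans (coeff-scale 1# p k) (*-identityˡ _)

    *ₚ-zeroˡ : ∀ p q → p ≋ [] → (p *ₚ q) ≋ []
    *ₚ-zeroˡ []      q e = ≋-refl
    *ₚ-zeroˡ (a ∷ p) q e =
      +ₚ-cong (scale-zero q (at e 0)) (0∷≋[] refl (*ₚ-zeroˡ p q (tail≋[] e)))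

    *ₚ-cong : ∀ {p p′ q q′} → p ≋ p′ → q ≋ q′ → (p *ₚ q) ≋ (p′ *ₚ q′)
    *ₚ-cong {[]}    {p′}      {q} {q′} e f = ≋-sym (*ₚ-zeroˡ p′ q′ (≋-sym e))
    *ₚ-cong {a ∷ p} {[]}      {q} {q′} e f = *ₚ-zeroˡ (a ∷ p) q e
    *ₚ-cong {a ∷ p} {a′ ∷ p′} {q} {q′} e f =
      +ₚ-cong (scale-cong (at e 0) f) (cons refl (*ₚ-cong {p} {p′} (tail≋ e) f))

    *ₚ-zeroʳ : ∀ p → (p *ₚ []) ≋ []
    *ₚ-zeroʳ []      = ≋-refl
    *ₚ-zeroʳ (a ∷ p) = 0∷≋[] refl (*ₚ-zeroʳ p)

    *ₚ-∷ʳ : ∀ p b q → (p *ₚ (b ∷ q)) ≋ (scale b p +ₚ (0# ∷ p *ₚ q))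
    *ₚ-∷ʳ []      b q = ≋-sym (0∷≋[] refl ≋-refl)
    *ₚ-∷ʳ (a ∷ p) b q = cons (+-cong (*-comm a b) refl)
      (≋-trans (+ₚ-cong ≋-refl (*ₚ-∷ʳ p b q))
      (≋-trans (≋-sym (+ₚ-assoc (scale a q) (scale b p) (0# ∷ p *ₚ q)))
      (≋-trans (+ₚ-cong (+ₚ-comm (scale a q) (scale b p)) ≋-refl)
               (+ₚ-assoc (scale b p) (scale a q) (0# ∷ p *ₚ q)))))

    *ₚ-comm : ∀ p q → (p *ₚ q) ≋ (q *ₚ p)
    *ₚ-comm []      q = ≋-sym (*ₚ-zeroʳ q)
    *ₚ-comm (a ∷ p) q =
      ≋-trans (+ₚ-cong ≋-refl (cons refl (*ₚ-comm p q))) (≋-sym (*ₚ-∷ʳ q a p))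

    0∷-+ₚ : ∀ p q → (0# ∷ (p +ₚ q)) ≋ ((0# ∷ p) +ₚ (0# ∷ q))
    0∷-+ₚ p q = cons (sym (+-identityˡ 0#)) ≋-refl

    *ₚ-distribʳ : ∀ r p q → ((p +ₚ q) *ₚ r) ≋ ((p *ₚ r) +ₚ (q *ₚ r))
    *ₚ-distribʳ r []      q       = ≋-refl
    *ₚ-distribʳ r (a ∷ p) []      = ≋-sym (+ₚ-identityʳ _)
    *ₚ-distribʳ r (a ∷ p) (b ∷ q) =
      ≋-trans (+ₚ-cong (scale-distribʳ a b r)
                (≋-trans (cons refl (*ₚ-distribʳ r p q)) (0∷-+ₚ (p *ₚ r) (q *ₚ r))))
              (+ₚ-interchange (scale a r) (scale b r) (0# ∷ p *ₚ r) (0# ∷ q *ₚ r))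

    *ₚ-distribˡ : ∀ r p q → (r *ₚ (p +ₚ q)) ≋ ((r *ₚ p) +ₚ (r *ₚ q))
    *ₚ-distribˡ r p q = ≋-trans (*ₚ-comm r (p +ₚ q))
      (≋-trans (*ₚ-distribʳ r p q) (+ₚ-cong (*ₚ-comm p r) (*ₚ-comm q r)))

    scale-*ₚ : ∀ a p q → (scale a p *ₚ q) ≋ scale a (p *ₚ q)
    scale-*ₚ a []      q = ≋-refl
    scale-*ₚ a (b ∷ p) q =
      ≋-trans (+ₚ-cong (scale-scale a b q) (cons (sym (zeroʳ a)) (scale-*ₚ a p q)))
              (≋-sym (scale-+ₚ a (scale b q) (0# ∷ p *ₚ q)))

    0∷-*ₚ : ∀ p q → ((0# ∷ p) *ₚ q) ≋ (0# ∷ p *ₚ q)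
    0∷-*ₚ p q = +ₚ-cong (scale-zero q refl) ≋-refl

    *ₚ-assoc : ∀ p q r → ((p *ₚ q) *ₚ r) ≋ (p *ₚ (q *ₚ r))
    *ₚ-assoc []      q r = ≋-refl
    *ₚ-assoc (a ∷ p) q r =
      ≋-trans (*ₚ-distribʳ r (scale a q) (0# ∷ p *ₚ q))
              (+ₚ-cong (scale-*ₚ a q r)
                (≋-trans (0∷-*ₚ (p *ₚ q) r) (cons refl (*ₚ-assoc p q r))))

    *ₚ-identityˡ : ∀ p → (const 1# *ₚ p) ≋ p
    *ₚ-identityˡ p =
      ≋-trans (+ₚ-cong (scale-one p) (0∷≋[] refl ≋-refl)) (+ₚ-identityʳ p)

    *ₚ-noZeroDivisor : ∀ p q → (p *ₚ q) ≋ [] → p ≋ [] ⊎ q ≋ []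
    *ₚ-noZeroDivisor []      q       e = inj₁ ≋-refl
    *ₚ-noZeroDivisor (a ∷ p) []      e = inj₂ ≋-refl
    *ₚ-noZeroDivisor (a ∷ p) (b ∷ q) e = Sum.[
      (λ a≈0 → Sum.map₁ (0∷≋[] a≈0) (*ₚ-noZeroDivisor p (b ∷ q)
        (tail≋[] (≋-trans (≋-sym (0∷-*ₚ p (b ∷ q)))
                 (≋-trans (*ₚ-cong {0# ∷ p} {a ∷ p} {b ∷ q} (cons (sym a≈0) ≋-refl) ≋-refl) e))))) ,
      (λ b≈0 → Sum.map₂ (0∷≋[] b≈0) (*ₚ-noZeroDivisor (a ∷ p) q
        (tail≋[] (≋-trans (≋-sym (+ₚ-cong (scale-zero (a ∷ p) b≈0) ≋-refl))
                 (≋-trans (≋-sym (*ₚ-∷ʳ (a ∷ p) b q)) e))))) ]′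
      (noZeroDivisor (trans (sym (+-identityʳ (a * b))) (at e 0)))

  polynomials : IntegralDomain c ℓ
  polynomials = record
    { commutativeRing = record
      { Carrier = Poly ; _≈_ = _≋_ ; _+_ = _+ₚ_ ; _*_ = _*ₚ_ ; -_ = -ₚ_
      ; 0# = [] ; 1# = const 1#
      ; isCommutativeRing = record
        { isRing = record
          { +-isAbelianGroup = record
            { isGroup = record
              { isMonoid = record
                { isSemigroup = record
                  { isMagma = record
                    { isEquivalence = record { refl = ≋-refl ; sym = ≋-sym ; trans = ≋-trans }
                    ; ∙-cong = +ₚ-cong }
                  ; assoc = +ₚ-assoc }
                ; identity = (λ _ → ≋-refl) , +ₚ-identityʳ }
              ; inverse = -ₚ-inverseˡ , -ₚ-inverseʳ
              ; ⁻¹-cong = -ₚ-cong }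
            ; comm = +ₚ-comm }
          ; *-cong = *ₚ-cong
          ; *-assoc = *ₚ-assoc
          ; *-identity = *ₚ-identityˡ , λ p → ≋-trans (*ₚ-comm p (const 1#)) (*ₚ-identityˡ p)
          ; distrib = *ₚ-distribˡ , *ₚ-distribʳ }
        ; *-comm = *ₚ-comm } }
    ; 1≉0 = λ e → 1≉0 (at e 0)
    ; noZeroDivisor = λ {p} {q} → *ₚ-noZeroDivisor p q
    }

module Fractions {c ℓ} (R : IntegralDomain c ℓ) where
  open IntegralDomain R
  open Algebra.Solver.Ring.NaturalCoefficients.Default commutativeSemiring
    using (solve; _:=_; _:+_; _:*_; con)
  open Relation.Binary.Reasoning.Setoid setoid

  record Fraction : Set (c ⊔ ℓ) where
    constructor mkFrac
    field
      num   : Carrier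
      den   : Carrier
      den≉0 : ¬ den ≈ 0#
  open Fraction public

  infix 4 _≃_
  record _≃_ (p q : Fraction) : Set ℓ where
    constructor mk≃
    field cross : num p * den q ≈ num q * den p
  open _≃_ public

  private
    *-nonzero : ∀ {x y} → ¬ x ≈ 0# → ¬ y ≈ 0# → ¬ x * y ≈ 0#
    *-nonzero x≉0 y≉0 e = Sum.[ x≉0 , y≉0 ]′ (noZeroDivisor e)

    x-y≈0⇒x≈y : ∀ {x y} → x + - y ≈ 0# → x ≈ y
    x-y≈0⇒x≈y {x} {y} e = begin
      x               ≈⟨ +-identityʳ x ⟨
      x + 0#          ≈⟨ +-congˡ (-‿inverseˡ y) ⟨
      x + (- y + y)   ≈⟨ +-assoc x (- y) y ⟨
      (x + - y) + y   ≈⟨ +-congʳ e ⟩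
      0# + y          ≈⟨ +-identityˡ y ⟩
      y               ∎

    cancelʳ : ∀ {x y z} → ¬ z ≈ 0# → x * z ≈ y * z → x ≈ y
    cancelʳ {x} {y} {z} z≉0 e = Sum.[ x-y≈0⇒x≈y , (λ z≈0 → contradiction z≈0 z≉0) ]′
      (noZeroDivisor (begin
        (x + - y) * z       ≈⟨ distribʳ z x (- y) ⟩
        x * z + - y * z     ≈⟨ +-congˡ (-‿distribˡ-* ring y z) ⟨
        x * z + - (y * z)   ≈⟨ +-congʳ e ⟩
        y * z + - (y * z)   ≈⟨ -‿inverseʳ _ ⟩
        0#                  ∎))

  infixl 6 _+ᶠ_
  infixl 7 _*ᶠ_ _/_⟨_⟩

  fromDomain : Carrier → Fraction
  fromDomain a = mkFrac a 1# 1≉0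

  0ᶠ 1ᶠ : Fraction
  0ᶠ = fromDomain 0#
  1ᶠ = fromDomain 1#

  _+ᶠ_ : Fraction → Fraction → Fraction
  mkFrac a b b≉0 +ᶠ mkFrac c d d≉0 = mkFrac (a * d + c * b) (b * d) (*-nonzero b≉0 d≉0)

  _*ᶠ_ : Fraction → Fraction → Fraction
  mkFrac a b b≉0 *ᶠ mkFrac c d d≉0 = mkFrac (a * c) (b * d) (*-nonzero b≉0 d≉0)

  -ᶠ_ : Fraction → Fraction
  -ᶠ mkFrac a b b≉0 = mkFrac (- a) b b≉0

  num≉0 : ∀ {x} → ¬ x ≃ 0ᶠ → ¬ num x ≈ 0#
  num≉0 {x} x≄0 e = x≄0 (mk≃ (begin
    num x * 1#    ≈⟨ *-congʳ e ⟩
    0# * 1#       ≈⟨ zeroˡ 1# ⟩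
    0#            ≈⟨ zeroˡ (den x) ⟨
    0# * den x    ∎))

  _/_⟨_⟩ : Fraction → (d : Fraction) → ¬ d ≃ 0ᶠ → Fraction
  x / d ⟨ d≄0 ⟩ = x *ᶠ mkFrac (den d) (num d) (num≉0 d≄0)

  fromDomain-nonzero : ∀ {a} → ¬ a ≈ 0# → ¬ fromDomain a ≃ 0ᶠ
  fromDomain-nonzero {a} a≉0 e = a≉0 (begin
    a        ≈⟨ *-identityʳ a ⟨
    a * 1#   ≈⟨ cross e ⟩
    0# * 1#  ≈⟨ zeroˡ 1# ⟩
    0#       ∎)

  private
    ≃-refl : ∀ {p} → p ≃ p
    ≃-refl = mk≃ refl

    ≃-sym : ∀ {p q} → p ≃ q → q ≃ p
    ≃-sym e = mk≃ (sym (cross e))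

    ≃-trans : ∀ {p q r} → p ≃ q → q ≃ r → p ≃ r
    ≃-trans {mkFrac a b _} {mkFrac c d d≉0} {mkFrac e f _} (mk≃ ad≈cb) (mk≃ cf≈ed) =
      mk≃ (cancelʳ d≉0 (begin
        a * f * d    ≈⟨ solve 3 (λ a f d → a :* f :* d := a :* d :* f) refl a f d ⟩
        a * d * f    ≈⟨ *-congʳ ad≈cb ⟩
        c * b * f    ≈⟨ solve 3 (λ c b f → c :* b :* f := c :* f :* b) refl c b f ⟩
        c * f * b    ≈⟨ *-congʳ cf≈ed ⟩
        e * d * b    ≈⟨ solve 3 (λ e d b → e :* d :* b := e :* b :* d) refl e d b ⟩
        e * b * d    ∎))

    +ᶠ-cong : ∀ {p p′ q q′} → p ≃ p′ → q ≃ q′ → (p +ᶠ q) ≃ (p′ +ᶠ q′)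
    +ᶠ-cong {mkFrac a b _} {mkFrac a′ b′ _} {mkFrac c d _} {mkFrac c′ d′ _} (mk≃ e) (mk≃ f) =
      mk≃ (begin
        (a * d + c * b) * (b′ * d′)
          ≈⟨ solve 6 (λ a d c b b′ d′ → (a :* d :+ c :* b) :* (b′ :* d′)
               := a :* b′ :* (d :* d′) :+ c :* d′ :* (b :* b′)) refl a d c b b′ d′ ⟩
        a * b′ * (d * d′) + c * d′ * (b * b′)
          ≈⟨ +-cong (*-congʳ e) (*-congʳ f) ⟩
        a′ * b * (d * d′) + c′ * d * (b * b′)
          ≈⟨ solve 6 (λ a′ b d d′ c′ b′ → a′ :* b :* (d :* d′) :+ c′ :* d :* (b :* b′)
               := (a′ :* d′ :+ c′ :* b′) :* (b :* d)) refl a′ b d d′ c′ b′ ⟩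
        (a′ * d′ + c′ * b′) * (b * d) ∎)

    *ᶠ-cong : ∀ {p p′ q q′} → p ≃ p′ → q ≃ q′ → (p *ᶠ q) ≃ (p′ *ᶠ q′)
    *ᶠ-cong {mkFrac a b _} {mkFrac a′ b′ _} {mkFrac c d _} {mkFrac c′ d′ _} (mk≃ e) (mk≃ f) =
      mk≃ (begin
        (a * c) * (b′ * d′)
          ≈⟨ solve 4 (λ a c b′ d′ → (a :* c) :* (b′ :* d′) := (a :* b′) :* (c :* d′)) refl a c b′ d′ ⟩
        (a * b′) * (c * d′)
          ≈⟨ *-cong e f ⟩
        (a′ * b) * (c′ * d)
          ≈⟨ solve 4 (λ a′ b c′ d → (a′ :* b) :* (c′ :* d) := (a′ :* c′) :* (b :* d)) refl a′ b c′ d ⟩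
        (a′ * c′) * (b * d) ∎)

    -ᶠ-cong : ∀ {p q} → p ≃ q → (-ᶠ p) ≃ (-ᶠ q)
    -ᶠ-cong {mkFrac a b _} {mkFrac c d _} (mk≃ e) = mk≃ (begin
      - a * d    ≈⟨ -‿distribˡ-* ring a d ⟨
      - (a * d)  ≈⟨ -‿cong e ⟩
      - (c * b)  ≈⟨ -‿distribˡ-* ring c b ⟩
      - c * b    ∎)

    +ᶠ-assoc : ∀ p q r → ((p +ᶠ q) +ᶠ r) ≃ (p +ᶠ (q +ᶠ r))
    +ᶠ-assoc (mkFrac a b _) (mkFrac c d _) (mkFrac e f _) = mk≃
      (solve 6 (λ a b c d e f →
          ((a :* d :+ c :* b) :* f :+ e :* (b :* d)) :* (b :* (d :* f))
          := (a :* (d :* f) :+ (c :* f :+ e :* d) :* b) :* (b :* d :* f)) refl a b c d e f)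

    +ᶠ-comm : ∀ p q → (p +ᶠ q) ≃ (q +ᶠ p)
    +ᶠ-comm (mkFrac a b _) (mkFrac c d _) = mk≃ (*-cong (+-comm _ _) (*-comm _ _))

    +ᶠ-identityˡ : ∀ p → (0ᶠ +ᶠ p) ≃ p
    +ᶠ-identityˡ (mkFrac a b _) = mk≃
      (solve 2 (λ a b → (con 0 :* b :+ a :* con 1) :* b := a :* (con 1 :* b)) refl a b)

    -ᶠ-inverseˡ : ∀ p → ((-ᶠ p) +ᶠ p) ≃ 0ᶠ
    -ᶠ-inverseˡ (mkFrac a b _) = mk≃ (begin
      (- a * b + a * b) * 1#  ≈⟨ *-congʳ (distribʳ b (- a) a) ⟨
      ((- a + a) * b) * 1#    ≈⟨ *-congʳ (*-congʳ (-‿inverseˡ a)) ⟩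
      (0# * b) * 1#           ≈⟨ *-congʳ (zeroˡ b) ⟩
      0# * 1#                 ≈⟨ zeroˡ 1# ⟩
      0#                      ≈⟨ zeroˡ (b * b) ⟨
      0# * (b * b)            ∎)

    *ᶠ-assoc : ∀ p q r → ((p *ᶠ q) *ᶠ r) ≃ (p *ᶠ (q *ᶠ r))
    *ᶠ-assoc (mkFrac a b _) (mkFrac c d _) (mkFrac e f _) =
      mk≃ (*-cong (*-assoc a c e) (sym (*-assoc b d f)))

    *ᶠ-comm : ∀ p q → (p *ᶠ q) ≃ (q *ᶠ p)
    *ᶠ-comm (mkFrac a b _) (mkFrac c d _) = mk≃ (*-cong (*-comm a c) (*-comm d b))

    *ᶠ-identityˡ : ∀ p → (1ᶠ *ᶠ p) ≃ p
    *ᶠ-identityˡ (mkFrac a b _) = mk≃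
      (solve 2 (λ a b → con 1 :* a :* b := a :* (con 1 :* b)) refl a b)

    *ᶠ-distribʳ : ∀ r p q → ((p +ᶠ q) *ᶠ r) ≃ ((p *ᶠ r) +ᶠ (q *ᶠ r))
    *ᶠ-distribʳ (mkFrac e f _) (mkFrac a b _) (mkFrac c d _) = mk≃
      (solve 6 (λ a b c d e f →
          ((a :* d :+ c :* b) :* e) :* ((b :* f) :* (d :* f))
          := (a :* e :* (d :* f) :+ c :* e :* (b :* f)) :* (b :* d :* f)) refl a b c d e f)

  fractions : CommutativeRing (c ⊔ ℓ) ℓ
  fractions = record
    { Carrier = Fraction ; _≈_ = _≃_ ; _+_ = _+ᶠ_ ; _*_ = _*ᶠ_ ; -_ = -ᶠ_
    ; 0# = 0ᶠ ; 1# = 1ᶠ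
    ; isCommutativeRing = record
      { isRing = record
        { +-isAbelianGroup = record
          { isGroup = record
            { isMonoid = record
              { isSemigroup = record
                { isMagma = record
                  { isEquivalence = record { refl = ≃-refl ; sym = ≃-sym ; trans = ≃-trans }
                  ; ∙-cong = +ᶠ-cong }
                ; assoc = +ᶠ-assoc }
              ; identity = +ᶠ-identityˡ
                , λ p → ≃-trans (+ᶠ-comm p 0ᶠ) (+ᶠ-identityˡ p) }
            ; inverse = -ᶠ-inverseˡ
              , λ p → ≃-trans (+ᶠ-comm p (-ᶠ p)) (-ᶠ-inverseˡ p)
            ; ⁻¹-cong = -ᶠ-cong }
          ; comm = +ᶠ-comm }
        ; *-cong = *ᶠ-cong
        ; *-assoc = *ᶠ-assoc
        ; *-identity = *ᶠ-identityˡ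
          , λ p → ≃-trans (*ᶠ-comm p 1ᶠ) (*ᶠ-identityˡ p)
        ; distrib = (λ r p q → ≃-trans (*ᶠ-comm r (p +ᶠ q))
                      (≃-trans (*ᶠ-distribʳ r p q) (+ᶠ-cong (*ᶠ-comm p r) (*ᶠ-comm q r))))
          , *ᶠ-distribʳ }
      ; *-comm = *ᶠ-comm } }

words : (m n : ℕ) → List (Vec (Fin m) n)
words m zero    = Vec.[] ∷ []
words m (suc n) = cartesianProductWith Vec._∷_ (allFin m) (words m n)

IsPermutation : ∀ {n} → Vec (Fin n) n → Set
IsPermutation π = Bijective _≡_ _≡_ (lookup π)

isPermutation? : ∀ {n} → Decidable (IsPermutation {n})
isPermutation? π = injective? ×-dec surjective?
  where
  injective? : Dec (Injective _≡_ _≡_ (lookup π))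
  injective? = map′ (λ inj {i} {j} → inj i j) (λ inj i j → inj {i} {j})
    (all? λ i → all? λ j → lookup π i Fin.≟ lookup π j →-dec i Fin.≟ j)

  surjective? : Dec (Surjective _≡_ _≡_ (lookup π))
  surjective? = map′
    (λ sur j → proj₁ (sur j) , λ { ≡.refl → proj₂ (sur j) })
    (λ sur j → proj₁ (sur j) , proj₂ (sur j) ≡.refl)
    (all? λ j → any? λ i → lookup π i Fin.≟ j)

𝔖 : (n : ℕ) → List (Vec (Fin n) n)
𝔖 n = filter isPermutation? (words n n)

count : ∀ {n p} {P : Fin n → Set p} → Decidable P → ℕ
count {n} P? = length (filter P? (allFin n))

des : ∀ {n} → Vec (Fin (suc n)) (suc n) → ℕ
des π = count λ i → lookup π (suc i) Fin.<? lookup π (inject₁ i)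

-- The element j of ± n stands for the integer toℕ j − n, so ± n is
-- {−n,…,n} in its usual order, opposite is negation, and n ↑ʳ i is the
-- nonnegative integer i ∈ {0,…,n}.

± : ℕ → Set
± n = Fin (n ℕ.+ suc n)

SignedWord : ℕ → Set
SignedWord n = Vec (± n) (n ℕ.+ suc n)

IsSigned : ∀ n → SignedWord n → Set
IsSigned n π = IsPermutation π × (∀ i → lookup π (opposite i) ≡ opposite (lookup π i))

isSigned? : ∀ n → Decidable (IsSigned n)
isSigned? n π = isPermutation? π
  ×-dec all? λ i → lookup π (opposite i) Fin.≟ opposite (lookup π i)

𝔅 : ∀ n → List (SignedWord n)
𝔅 n = filter (isSigned? n) (words (n ℕ.+ suc n) (n ℕ.+ suc n))

neg : ∀ n → SignedWord n → ℕ
neg n π = count λ i → lookup π (n ↑ʳ suc i) Fin.<? n ↑ʳ zero {n}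

desB : ∀ n → SignedWord n → ℕ
desB n π = count λ i → lookup π (n ↑ʳ suc i) Fin.<? lookup π (n ↑ʳ inject₁ i)

-- If π is signed and π₁ < 0 = π₀ then desB n π ≥ 1, so ∸ does not truncate;
-- π₁ = 0 does not occur for signed π.

fdes : ∀ n → .{{NonZero n}} → SignedWord n → ℕ
fdes n@(suc _) π =
  if does (lookup π (n ↑ʳ suc zero) Fin.<? n ↑ʳ zero {n})
  then 2 ℕ.* desB n π ∸ 1
  else 2 ℕ.* desB n π

-- Aₙ and Fₙ are given by their values in a commutative ring, so that Aₙ(t²)
-- needs no substitution operation on polynomials.

module Enumerators {c ℓ} (R : CommutativeRing c ℓ) where
  open CommutativeRing R
  open Algebra.Properties.Semiring.Exp semiring using (_^_)

  ∑[_] : ∀ {a} {I : Set a} → List I → (I → Carrier) → Carrier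
  ∑[ xs ] f = foldr _+_ 0# (map f xs)

  A : ℕ → Carrier → Carrier
  A zero      t = 1#
  A n@(suc _) t = ∑[ 𝔖 n ] λ π → t ^ (des π ℕ.+ 1)

  F : (n : ℕ) → .{{NonZero n}} → Carrier → Carrier → Carrier
  F n y t = ∑[ 𝔅 n ] λ π → y ^ neg n π * t ^ fdes n π

-- ℤ(y,t) is built as the fractions of ℤ[y][t]: the outer indeterminate is t,
-- and y is a constant of the outer polynomial ring.

ℤ-domain : IntegralDomain 0ℓ 0ℓ
ℤ-domain = record
  { commutativeRing = ℤ.+-*-commutativeRing
  ; 1≉0             = λ ()
  ; noZeroDivisor   = λ {i} → ℤ.i*j≡0⇒i≡0∨j≡0 i
  }

module ℤ[y]   = Polynomial ℤ-domain
module ℤ[y,t] = Polynomial ℤ[y].polynomials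
module ℤ⟨y,t⟩ = Fractions ℤ[y,t].polynomials

open ℤ⟨y,t⟩ public using (_/_⟨_⟩)
open CommutativeRing ℤ⟨y,t⟩.fractions public
open Algebra.Properties.Semiring.Exp semiring public using (_^_)
open Algebra.Properties.Semiring.Mult semiring public using (_×_)
open Algebra.Properties.Semiring.Sum semiring public using (sum⁺-syntax)
open Enumerators ℤ⟨y,t⟩.fractions public using (A; F)

y t : Carrier
y = ℤ⟨y,t⟩.fromDomain (ℤ[y,t].const ℤ[y].X)
t = ℤ⟨y,t⟩.fromDomain ℤ[y,t].X

t≉0 : ¬ t ≈ 0#
t≉0 = ℤ⟨y,t⟩.fromDomain-nonzero λ e → contradiction (ℤ[y].at (ℤ[y,t].at e 1) 0) λ ()

1+t≉0 : ¬ 1# + t ≈ 0#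
1+t≉0 e = contradiction (ℤ[y].at (ℤ[y,t].at (ℤ⟨y,t⟩.cross e) 0) 0) λ ()

-- Put x = t², c = 1 − x, and let G n g be the sum of y^neg x^drops over the signed permutations π of
-- [n], where drops counts the descents of π preceded by a pivot lying in the gap g between two
-- consecutive values. Splitting by the sign of π₁ gives t (1 + t) F n = G n ∞ + t G n 0. Removing
-- π₁ and standardizing leaves a signed permutation of [n − 1] preceded by a pivot in the gap left by
-- π₁, so G satisfies a recurrence in n; moving g past one value changes one summand, whence
--   G (n+1) (+j) = G (n+1) (+(j+1)) + c G n (+j),   G (n+1) (−(j+1)) = G (n+1) (−j) + c y G n (−j).
-- Read Dⁿ umbrally as D n = G n ∞. The first relation gives G n 0 = (D + c)ⁿ, the second then gives
-- G n (−∞) = (D + c (1 + y))ⁿ, and G n ∞ = x G n (−∞) for n ≥ 1. Since c is invertible, the resulting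
-- recurrence Dⁿ = x (D + c (1 + y))ⁿ determines D. Unsigned permutations satisfy the same relations
-- with y = 0, so D n = (1 + y)ⁿ A n by homogeneity, and (D + c)ⁿ is the sum in the theorem.

module Submission where

open import Algebra.Bundles using (CommutativeRing)
import Algebra.Properties.Group
import Algebra.Properties.Semiring.Exp
import Algebra.Properties.Semiring.Mult
import Algebra.Properties.Semiring.Sum
import Algebra.Solver.Ring.NaturalCoefficients.Default
open import Data.Bool.Base using (Bool; true; false; not; if_then_else_; _xor_)
open import Data.Bool.Properties as Bool using (¬-not; not-involutive)
open import Data.Fin.Base as Fin
  using (Fin; zero; suc; toℕ; inject₁; opposite; punchIn; punchOut; splitAt; _↑ˡ_; _↑ʳ_)
open import Data.Fin.Properties as Fin
  using ( any?; injective⇒≤; opposite-involutive; opposite-prop; punchIn-injective; punchIn-punchOut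
        ; punchInᵢ≢i; punchOut-injective; splitAt-↑ˡ; splitAt-↑ʳ; splitAt⁻¹-↑ˡ; splitAt⁻¹-↑ʳ
        ; toℕ-injective; toℕ-↑ˡ; toℕ-↑ʳ; toℕ<n )
open import Data.List.Base as List
  using (List; []; _∷_; _++_; allFin; cartesianProduct; cartesianProductWith; filter; length)
open import Data.List.Membership.Propositional using (_∈_)
open import Data.List.Membership.Propositional.Properties
  using ( ∈-allFin; ∈-cartesianProduct⁺; ∈-cartesianProduct⁻; ∈-cartesianProductWith⁺
        ; ∈-cartesianProductWith⁻; ∈-filter⁺; ∈-filter⁻; ∈-map⁺; ∈-map⁻ )
open import Data.List.Membership.Propositional.Properties.WithK using (unique∧set⇒bag)
open import Data.List.Relation.Binary.BagAndSetEquality using (∼bag⇒↭)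
open import Data.List.Relation.Binary.Permutation.Propositional as ↭ using (_↭_; prep; swap)
open import Data.List.Relation.Unary.All using ([]; _∷_)
open import Data.List.Relation.Unary.Any using (here; there)
open import Data.List.Relation.Unary.Unique.Propositional using (Unique; []; _∷_)
import Data.List.Relation.Unary.Unique.Propositional.Properties as Unique
open import Data.Maybe.Base as Maybe using (Maybe; just; nothing)
open import Data.Maybe.Properties using (just-injective)
open import Data.Nat.Base as ℕ using (ℕ; zero; suc; _∸_; _<ᵇ_; z≤n; s≤s; NonZero)
open import Data.Nat.Combinatorics using (_C_; k>n⇒nCk≡0; nCk+nC[k+1]≡[n+1]C[k+1])
import Data.Nat.Properties as ℕ
open import Data.Product.Base as Product using (_,_; proj₁; proj₂; ∃; map₁; map₂)
open import Data.Product.Properties using (,-injective)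
open import Data.Sum.Base using (inj₁; inj₂)
open import Data.Vec.Base as Vec using (Vec; []; _∷_; lookup; tabulate)
open import Data.Vec.Properties
  using (∷-injective; lookup-map; lookup∘tabulate; tabulate∘lookup; tabulate-cong)
open import Defs
  using ( IntegralDomain; module Fractions; module Enumerators; words; IsPermutation; isPermutation?
        ; 𝔖; count; des; ±; SignedWord; IsSigned; isSigned?; 𝔅; neg; desB; fdes )
open import Function.Base using (_∘_; id)
open import Function.Bundles using (mk⇔)
open import Function.Definitions using (Injective; Surjective)
open import Relation.Binary.PropositionalEquality as ≡ using (_≡_; _≢_; cong; cong₂; subst)
import Relation.Binary.Reasoning.Setoid
open import Relation.Nullary.Decidable using (yes; no; does; does-⇔)
open import Relation.Nullary.Negation using (¬_; contradiction)
open import Relation.Unary using (Decidable)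

bit : Bool → ℕ
bit b = if b then 1 else 0

-- The gap (false , j) lies between the values j and j + 1, and (true , j) between −(j + 1) and −j;
-- thus (false , 0) and (true , 0) both stand for 0. The letter (s , k) has absolute value k + 1
-- and is negative when s is true.

Gap : Set
Gap = Bool Product.× ℕ

-- Among negative values a larger absolute value means a smaller value: -(k + 1) lies below the gap
-- from -(j + 1) to -j exactly when k ≥ j, whence the `not`.
below : Bool Product.× ℕ → Gap → Bool
below (false , k) (false , j) = k <ᵇ j
below (true  , k) (true  , j) = not (k <ᵇ j)
below (true  , _) (false , _) = true
below (false , _) (true  , _) = false

<ᵇ-true : ∀ {k j} → k ℕ.< j → (k <ᵇ j) ≡ true
<ᵇ-true {zero}  (s≤s _)           = ≡.refl
<ᵇ-true {suc k} (s≤s k<j@(s≤s _)) = <ᵇ-true k<j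

<ᵇ-false : ∀ {k j} → j ℕ.≤ k → (k <ᵇ j) ≡ false
<ᵇ-false z≤n       = ≡.refl
<ᵇ-false (s≤s j≤k) = <ᵇ-false j≤k

-- Powers of E + b, where E is the shift of sequences

module Umbral {a ℓ} (R : CommutativeRing a ℓ) where
  open CommutativeRing R hiding (zero)
  open Algebra.Properties.Group +-group using () renaming (∙-cancelʳ to +-cancelʳ)
  open Algebra.Properties.Semiring.Exp semiring using (_^_; ^-congʳ)
  open Algebra.Properties.Semiring.Mult semiring
    using (×-congʳ; ×-congˡ; ×-homo-+; ×-comm-*) renaming (_×_ to _·_)
  open Algebra.Properties.Semiring.Sum semiring
    using (sum; sum-cong-≋; ∑-distrib-+; *-distribˡ-sum; sum⁺-syntax)
  open Algebra.Solver.Ring.NaturalCoefficients.Default commutativeSemiring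
    using (solve; _:=_; _:+_; _:*_; con)
  open Relation.Binary.Reasoning.Setoid setoid

  shift : Carrier → (ℕ → Carrier) → ℕ → Carrier
  shift b f j = f (suc j) + b * f j

  shift^ : Carrier → ℕ → (ℕ → Carrier) → ℕ → Carrier
  shift^ b zero    f = f
  shift^ b (suc m) f = shift b (shift^ b m f)

  shift^-local : ∀ {b b′ f g} m j → b ≈ b′ → (∀ k → k ℕ.≤ m ℕ.+ j → f k ≈ g k) →
                 shift^ b m f j ≈ shift^ b′ m g j
  shift^-local zero    j b≈b′ f≈g = f≈g j ℕ.≤-refl
  shift^-local (suc m) j b≈b′ f≈g = +-cong
    (shift^-local m (suc j) b≈b′ λ k k≤ → f≈g k (subst (k ℕ.≤_) (ℕ.+-suc m j) k≤))
    (*-cong b≈b′ (shift^-local m j b≈b′ λ k k≤ → f≈g k (ℕ.m≤n⇒m≤1+n k≤)))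

  shift^-cong : ∀ {b b′ f g} m j → b ≈ b′ → (∀ k → f k ≈ g k) → shift^ b m f j ≈ shift^ b′ m g j
  shift^-cong m j b≈b′ f≈g = shift^-local m j b≈b′ λ k _ → f≈g k

  -- The recurrence fills the array row by row from row `zero`. Identities about `shift^` are
  -- therefore proved by reading the other side as an array in m and j and checking the recurrence.
  shift^-unique : ∀ b (F : ℕ → ℕ → Carrier) →
                  (∀ m j → F (suc m) j ≈ F m (suc j) + b * F m j) →
                  ∀ m j → F m j ≈ shift^ b m (F zero) j
  shift^-unique b F rec zero    j = refl
  shift^-unique b F rec (suc m) j = trans (rec m j)
    (+-cong (shift^-unique b F rec m (suc j)) (*-congˡ (shift^-unique b F rec m j)))

  shift^-linear : ∀ b d f g m j →
                  shift^ b m (λ k → f k + d * g k) j ≈ shift^ b m f j + d * shift^ b m g j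
  shift^-linear b d f g m j = sym (shift^-unique b
    (λ m j → shift^ b m f j + d * shift^ b m g j)
    (λ m j → solve 6 (λ f₁ f₀ g₁ g₀ b d →
        (f₁ :+ b :* f₀) :+ d :* (g₁ :+ b :* g₀) := (f₁ :+ d :* g₁) :+ b :* (f₀ :+ d :* g₀)) refl
      (shift^ b m f (suc j)) (shift^ b m f j) (shift^ b m g (suc j)) (shift^ b m g j) b d) m j)

  shift^-shift : ∀ b m f j → shift^ b m (shift b f) j ≈ shift^ b (suc m) f j
  shift^-shift b zero    f j = refl
  shift^-shift b (suc m) f j =
    +-cong (shift^-shift b m f (suc j)) (*-congˡ (shift^-shift b m f j))

  -- Umbrally, (D + b)ᵐ Dʲ is homogeneous of degree m + j in D and b.
  shift^-scale : ∀ r b f m j →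
                 shift^ (r * b) m (λ k → r ^ k * f k) j ≈ r ^ (m ℕ.+ j) * shift^ b m f j
  shift^-scale r b f m j = sym (shift^-unique (r * b) (λ m j → r ^ (m ℕ.+ j) * shift^ b m f j)
    (λ m j → begin
      r * r ^ (m ℕ.+ j) * (shift^ b m f (suc j) + b * shift^ b m f j)
        ≈⟨ solve 5 (λ r p f₁ f₀ b →
             r :* p :* (f₁ :+ b :* f₀) := r :* p :* f₁ :+ r :* b :* (p :* f₀)) refl
           r (r ^ (m ℕ.+ j)) (shift^ b m f (suc j)) (shift^ b m f j) b ⟩
      r * r ^ (m ℕ.+ j) * shift^ b m f (suc j) + r * b * (r ^ (m ℕ.+ j) * shift^ b m f j)
        ≈⟨ +-congʳ (*-congʳ (^-congʳ r (≡.sym (ℕ.+-suc m j)))) ⟩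
      r ^ (m ℕ.+ suc j) * shift^ b m f (suc j) + r * b * (r ^ (m ℕ.+ j) * shift^ b m f j) ∎) m j)

  -- Umbrally, (f + b + d)ᵐ (f + b)ⁱ expands by powers of f + b.
  shift^-∘ : ∀ b d f m i →
             shift^ d m (λ k → shift^ b k f 0) i ≈ shift^ (b + d) m (shift^ b i f) 0
  shift^-∘ b d f m i = sym (shift^-unique d (λ m i → shift^ (b + d) m (shift^ b i f) 0)
    (λ m i → begin
      shift^ (b + d) (suc m) (shift^ b i f) 0
        ≈⟨ shift^-shift (b + d) m (shift^ b i f) 0 ⟨
      shift^ (b + d) m (shift (b + d) (shift^ b i f)) 0
        ≈⟨ shift^-cong m 0 refl (λ k →
             solve 4 (λ f₁ f₀ b d → f₁ :+ (b :+ d) :* f₀ := (f₁ :+ b :* f₀) :+ d :* f₀) refl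
             (shift^ b i f (suc k)) (shift^ b i f k) b d) ⟩
      shift^ (b + d) m (λ k → shift^ b (suc i) f k + d * shift^ b i f k) 0
        ≈⟨ shift^-linear (b + d) d (shift^ b (suc i) f) (shift^ b i f) m 0 ⟩
      shift^ (b + d) m (shift^ b (suc i) f) 0 + d * shift^ (b + d) m (shift^ b i f) 0 ∎) m i)

  -- The value f (m + j) enters `shift^ b m f j` with coefficient 1, and all other arguments are
  -- smaller. So sequences that agree below m + j give results differing by f (m + j) - g (m + j),
  -- here written without subtraction.
  shift^-leading : ∀ b f g m j → (∀ k → k ℕ.< m ℕ.+ j → f k ≈ g k) →
                   shift^ b m f j + g (m ℕ.+ j) ≈ shift^ b m g j + f (m ℕ.+ j)
  shift^-leading b f g zero    j f≈g = +-comm _ _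
  shift^-leading b f g (suc m) j f≈g = begin
    (shift^ b m f (suc j) + b * shift^ b m f j) + g (suc (m ℕ.+ j))
      ≡⟨ cong (λ k → (shift^ b m f (suc j) + b * shift^ b m f j) + g k) (ℕ.+-suc m j) ⟨
    (shift^ b m f (suc j) + b * shift^ b m f j) + g (m ℕ.+ suc j)
      ≈⟨ solve 3 (λ p q r → p :+ q :+ r := p :+ r :+ q) refl
         (shift^ b m f (suc j)) (b * shift^ b m f j) (g (m ℕ.+ suc j)) ⟩
    (shift^ b m f (suc j) + g (m ℕ.+ suc j)) + b * shift^ b m f j
      ≈⟨ +-cong
           (shift^-leading b f g m (suc j) λ k k< → f≈g k (subst (k ℕ.<_) (ℕ.+-suc m j) k<))
           (*-congˡ (shift^-local m j refl λ k k≤ → f≈g k (s≤s k≤))) ⟩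
    (shift^ b m g (suc j) + f (m ℕ.+ suc j)) + b * shift^ b m g j
      ≈⟨ solve 3 (λ p q r → p :+ q :+ r := p :+ r :+ q) refl
         (shift^ b m g (suc j)) (f (m ℕ.+ suc j)) (b * shift^ b m g j) ⟩
    (shift^ b m g (suc j) + b * shift^ b m g j) + f (m ℕ.+ suc j)
      ≡⟨ cong (λ k → (shift^ b m g (suc j) + b * shift^ b m g j) + f k) (ℕ.+-suc m j) ⟩
    (shift^ b m g (suc j) + b * shift^ b m g j) + f (suc (m ℕ.+ j)) ∎

  ∑-last : ∀ (f : ℕ → Carrier) n → ∑[ k ≤ n ] f (toℕ k) ≈ sum {n} (f ∘ toℕ) + f n
  ∑-last f zero    = +-comm _ _
  ∑-last f (suc n) = begin
    f 0 + ∑[ k ≤ n ] f (suc (toℕ k))                ≈⟨ +-congˡ (∑-last (f ∘ suc) n) ⟩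
    f 0 + (sum {n} (f ∘ suc ∘ toℕ) + f (suc n))     ≈⟨ +-assoc _ _ _ ⟨
    f 0 + sum {n} (f ∘ suc ∘ toℕ) + f (suc n)       ∎

  -- By Pascal's rule the binomial sums obey the recurrence of `shift^-unique`; their row 0 is the
  -- single term f j.
  shift^-binomial : ∀ b f n j →
    shift^ b n f j ≈ ∑[ k ≤ n ] ((n C toℕ k) · (b ^ (n ∸ toℕ k) * f (j ℕ.+ toℕ k)))
  shift^-binomial b f n j = sym (trans
    (shift^-unique b (λ n j → ∑[ k ≤ n ] term n j (toℕ k)) rec n j)
    (shift^-cong n j refl λ k → begin
      1 · (1# * f (k ℕ.+ 0)) + 0#  ≈⟨ solve 1 (λ z → con 1 :* z :+ con 0 :+ con 0 := z) refl _ ⟩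
      f (k ℕ.+ 0)                  ≡⟨ cong f (ℕ.+-identityʳ k) ⟩
      f k                          ∎))
    where
    term : ℕ → ℕ → ℕ → Carrier
    term n j k = (n C k) · (b ^ (n ∸ k) * f (j ℕ.+ k))

    b*term : ∀ n j k → k ℕ.< suc n → b * term n j (suc k) ≈ (n C suc k) · (b ^ (n ∸ k) * f (j ℕ.+ suc k))
    b*term n j k (s≤s k≤n) with ℕ.m≤n⇒m<n∨m≡n k≤n
    ... | inj₁ k<n = begin
      b * ((n C suc k) · (b ^ (n ∸ suc k) * f (j ℕ.+ suc k)))  ≈⟨ ×-comm-* (n C suc k) b _ ⟩
      (n C suc k) · (b * (b ^ (n ∸ suc k) * f (j ℕ.+ suc k)))  ≈⟨ ×-congʳ (n C suc k) (*-assoc _ _ _) ⟨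
      (n C suc k) · (b ^ suc (n ∸ suc k) * f (j ℕ.+ suc k))
        ≈⟨ ×-congʳ (n C suc k) (*-congʳ (^-congʳ b (ℕ.+-∸-assoc 1 k<n))) ⟨
      (n C suc k) · (b ^ (n ∸ k) * f (j ℕ.+ suc k))            ∎
    -- At k = n the exponent `n ∸ suc k` truncates and the powers of b no longer match, but n C (n +
    -- 1) = 0 makes both sides vanish.
    ... | inj₂ ≡.refl rewrite k>n⇒nCk≡0 {k} {suc k} ℕ.≤-refl = zeroʳ b

    pascal : ∀ n j k → k ℕ.< suc n → term (suc n) j (suc k) ≈ term n (suc j) k + b * term n j (suc k)
    pascal n j k k<1+n = begin
      (suc n C suc k) · (b ^ (n ∸ k) * f (j ℕ.+ suc k))
        ≈⟨ ×-congˡ (nCk+nC[k+1]≡[n+1]C[k+1] n k) ⟨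
      (n C k ℕ.+ n C suc k) · (b ^ (n ∸ k) * f (j ℕ.+ suc k))
        ≈⟨ ×-homo-+ _ (n C k) (n C suc k) ⟩
      (n C k) · (b ^ (n ∸ k) * f (j ℕ.+ suc k)) + (n C suc k) · (b ^ (n ∸ k) * f (j ℕ.+ suc k))
        ≈⟨ +-cong (×-congʳ (n C k) (*-congˡ (reflexive (cong f (ℕ.+-suc j k)))))
                  (sym (b*term n j k k<1+n)) ⟩
      term n (suc j) k + b * term n j (suc k) ∎

    rec : ∀ n j → ∑[ k ≤ suc n ] term (suc n) j (toℕ k) ≈
                  ∑[ k ≤ n ] term n (suc j) (toℕ k) + b * ∑[ k ≤ n ] term n j (toℕ k)
    rec n j = begin
      term (suc n) j 0 + ∑[ k ≤ n ] term (suc n) j (suc (toℕ k))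
        ≈⟨ +-cong
             (solve 3 (λ b p z → b :* p :* z :+ con 0 := b :* (p :* z :+ con 0)) refl b (b ^ n) (f (j ℕ.+ 0)))
             (sum-cong-≋ {suc n} (λ k → pascal n j (toℕ k) (toℕ<n k))) ⟩
      b * term n j 0 + ∑[ k ≤ n ] (term n (suc j) (toℕ k) + b * term n j (suc (toℕ k)))
        ≈⟨ +-congˡ (∑-distrib-+ {suc n} (term n (suc j) ∘ toℕ) (λ k → b * term n j (suc (toℕ k)))) ⟩
      b * term n j 0 + (∑[ k ≤ n ] term n (suc j) (toℕ k) + ∑[ k ≤ n ] (b * term n j (suc (toℕ k))))
        ≈⟨ +-congˡ (+-congˡ (*-distribˡ-sum {suc n} b (λ k → term n j (suc (toℕ k))))) ⟨
      b * term n j 0 + (∑[ k ≤ n ] term n (suc j) (toℕ k) + b * ∑[ k ≤ n ] term n j (suc (toℕ k)))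
        -- The separate k = 0 term completes the shifted sum to k ≤ n + 1, whose last term carries n
        -- C (n + 1) = 0.
        ≈⟨ solve 4 (λ b p q r → b :* p :+ (q :+ b :* r) := q :+ b :* (p :+ r)) refl b _ _ _ ⟩
      ∑[ k ≤ n ] term n (suc j) (toℕ k) + b * ∑[ k ≤ suc n ] term n j (toℕ k)
        ≈⟨ +-congˡ (*-congˡ (∑-last (term n j) (suc n))) ⟩
      ∑[ k ≤ n ] term n (suc j) (toℕ k) + b * (∑[ k ≤ n ] term n j (toℕ k) + term n j (suc n))
        ≈⟨ +-congˡ (*-congˡ (+-congˡ (×-congˡ (k>n⇒nCk≡0 (ℕ.≤-refl {suc n}))))) ⟩
      ∑[ k ≤ n ] term n (suc j) (toℕ k) + b * (∑[ k ≤ n ] term n j (toℕ k) + 0#)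
        ≈⟨ +-congˡ (*-congˡ (+-identityʳ _)) ⟩
      ∑[ k ≤ n ] term n (suc j) (toℕ k) + b * ∑[ k ≤ n ] term n j (toℕ k) ∎

  -- Raising the threshold from j to j + 1 changes only the summand k = j, from `ω false` to
  -- `ω true`. Each side is given the version that it lacks, which avoids subtraction.
  ∑-cut : ∀ (ω : Bool → Carrier) (h : ℕ → Carrier) {n j} → j ℕ.< n →
          sum {n} (λ k → ω (toℕ k <ᵇ j) * h (toℕ k)) + ω true * h j ≈
          sum {n} (λ k → ω (toℕ k <ᵇ suc j) * h (toℕ k)) + ω false * h j
  ∑-cut ω h {suc n} {zero} (s≤s _) =
    solve 3 (λ p q r → p :+ q :+ r := r :+ q :+ p) refl
      (ω false * h 0) (sum {n} (λ k → ω false * h (suc (toℕ k)))) (ω true * h 0)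
  ∑-cut ω h {suc n} {suc j} (s≤s j<n) = begin
    ω true * h 0 + sum {n} (λ k → ω (toℕ k <ᵇ j) * h (suc (toℕ k))) + ω true * h (suc j)
      ≈⟨ +-assoc _ _ _ ⟩
    ω true * h 0 + (sum {n} (λ k → ω (toℕ k <ᵇ j) * h (suc (toℕ k))) + ω true * h (suc j))
      ≈⟨ +-congˡ (∑-cut ω (h ∘ suc) j<n) ⟩
    ω true * h 0 + (sum {n} (λ k → ω (toℕ k <ᵇ suc j) * h (suc (toℕ k))) + ω false * h (suc j))
      ≈⟨ +-assoc _ _ _ ⟨
    ω true * h 0 + sum {n} (λ k → ω (toℕ k <ᵇ suc j) * h (suc (toℕ k))) + ω false * h (suc j) ∎

  -- Gap recurrences and their solution

  record GapRecurrence (x e : Carrier) (G : ℕ → Gap → Carrier) : Set ℓ where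
    field
      base : ∀ g → G 0 g ≈ 1#
      -- Each summand removes a first letter with code `(s , k)`. After standardization the rest of
      -- the word sees it as a pivot in the gap with the same code. The factor x records a drop from
      -- g, and e a negative letter; e = 0# gives the unsigned case.
      step : ∀ n g → G (suc n) g ≈ ∑[ k ≤ n ]
        (x ^ bit (below (true  , toℕ k) g) * (e * G n (true , toℕ k)) +
         x ^ bit (below (false , toℕ k) g) * G n (false , toℕ k))

  module _ {x c c⁻¹ : Carrier} (x+c≈1 : x + c ≈ 1#) (c⁻¹*c≈1 : c⁻¹ * c ≈ 1#) where

    x*h+c*h : ∀ h → x * h + c * h ≈ h
    x*h+c*h h = trans (sym (distribʳ h x c)) (trans (*-congʳ x+c≈1) (*-identityˡ h))

    module Gaps {e} {G : ℕ → Gap → Carrier} (isGap : GapRecurrence x e G) where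
      open GapRecurrence isGap

      top : ℕ → Carrier
      top n = G n (false , n)

      private
        negatives positives : ℕ → Gap → Carrier
        negatives n g = ∑[ k ≤ n ] (x ^ bit (below (true , toℕ k) g) * (e * G n (true , toℕ k)))
        positives n g = ∑[ k ≤ n ] (x ^ bit (below (false , toℕ k) g) * G n (false , toℕ k))

      split : ∀ n g → G (suc n) g ≈ negatives n g + positives n g
      split n g = trans (step n g) (∑-distrib-+ {suc n}
        (λ k → x ^ bit (below (true  , toℕ k) g) * (e * G n (true , toℕ k)))
        (λ k → x ^ bit (below (false , toℕ k) g) * G n (false , toℕ k)))

      -- Passing the letter `(false , j)` changes its factor from 1 to x, and 1 - x = c. Both sides
      -- are padded by x h so that `∑-cut` applies.
      false-step : ∀ {n j} → j ℕ.≤ n →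
                   G (suc n) (false , j) ≈ G (suc n) (false , suc j) + c * G n (false , j)
      false-step {n} {j} j≤n = +-cancelʳ (x ^ 1 * h) _ _ (begin
        G (suc n) (false , j) + x ^ 1 * h
          ≈⟨ +-congʳ (split n (false , j)) ⟩
        negatives n (false , j) + positives n (false , j) + x ^ 1 * h
          ≈⟨ +-assoc _ _ _ ⟩
        negatives n (false , j) + (positives n (false , j) + x ^ 1 * h)
          ≈⟨ +-congˡ (∑-cut (λ b → x ^ bit b) (λ k → G n (false , k)) (s≤s j≤n)) ⟩
        negatives n (false , j) + (positives n (false , suc j) + 1# * h)
          ≈⟨ +-assoc _ _ _ ⟨
        -- Every negative letter is below every gap `(false , _)`, so the two `negatives` sums agree
        -- by computation.
        negatives n (false , suc j) + positives n (false , suc j) + 1# * h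
          ≈⟨ +-cong (split n (false , suc j)) (trans (x*h+c*h h) (sym (*-identityˡ h))) ⟨
        G (suc n) (false , suc j) + (x * h + c * h)
          ≈⟨ solve 4 (λ p x c h → p :+ (x :* h :+ c :* h) := p :+ c :* h :+ x :* con 1 :* h) refl
             (G (suc n) (false , suc j)) x c h ⟩
        G (suc n) (false , suc j) + c * h + x ^ 1 * h ∎)
        where h = G n (false , j)

      -- The letter -(j + 1) lies below the gap `(true , j)` but above `(true , suc j)`, so its
      -- factor changes from x to 1. Hence the complemented weight `bit (not b)` and the use of
      -- `∑-cut` from right to left.
      true-step : ∀ {n j} → j ℕ.≤ n →
                  G (suc n) (true , suc j) ≈ G (suc n) (true , j) + c * e * G n (true , j)
      true-step {n} {j} j≤n = +-cancelʳ (x ^ 1 * h) _ _ (begin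
        G (suc n) (true , suc j) + x ^ 1 * h
          ≈⟨ +-congʳ (split n (true , suc j)) ⟩
        negatives n (true , suc j) + positives n (true , suc j) + x ^ 1 * h
          ≈⟨ solve 3 (λ p q r → p :+ q :+ r := p :+ r :+ q) refl
             (negatives n (true , suc j)) (positives n (true , suc j)) (x ^ 1 * h) ⟩
        negatives n (true , suc j) + x ^ 1 * h + positives n (true , j)
          ≈⟨ +-congʳ (∑-cut (λ b → x ^ bit (not b)) (λ k → e * G n (true , k)) (s≤s j≤n)) ⟨
        negatives n (true , j) + 1# * h + positives n (true , j)
          ≈⟨ solve 3 (λ p q r → p :+ r :+ q := p :+ q :+ r) refl
             (negatives n (true , j)) (positives n (true , j)) (1# * h) ⟩
        negatives n (true , j) + positives n (true , j) + 1# * h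
          ≈⟨ +-cong (split n (true , j)) (trans (x*h+c*h h) (sym (*-identityˡ h))) ⟨
        G (suc n) (true , j) + (x * h + c * h)
          ≈⟨ solve 5 (λ p x c e g → p :+ (x :* (e :* g) :+ c :* (e :* g))
                        := p :+ c :* e :* g :+ x :* con 1 :* (e :* g)) refl
             (G (suc n) (true , j)) x c e (G n (true , j)) ⟩
        G (suc n) (true , j) + c * e * G n (true , j) + x ^ 1 * h ∎)
        where h = e * G n (true , j)

      -- Both codes stand for 0, and `below` treats them alike on every letter, so the two instances
      -- of `step` have the same right-hand side by computation.
      true≈false : ∀ n → G n (true , 0) ≈ G n (false , 0)
      true≈false zero    = trans (base (true , 0)) (sym (base (false , 0)))
      true≈false (suc n) = trans (step n (true , 0)) (sym (step n (false , 0)))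

      -- With m = n - j, the distance from the topmost gap, `false-step` is the recurrence of E + c,
      -- and its row m = 0 is `top`.
      false-shift : ∀ m j → G (m ℕ.+ j) (false , j) ≈ shift^ c m top j
      false-shift = shift^-unique c (λ m j → G (m ℕ.+ j) (false , j)) λ m j →
        trans (false-step (ℕ.m≤n+m j m))
          (+-congʳ (reflexive (cong (λ n → G n (false , suc j)) (≡.sym (ℕ.+-suc m j)))))

      -- Now the row index m is the gap itself. `true-step` applies E + c e repeatedly, starting at
      -- the gap 0, where `false-shift` gives (D + c)ᵏ; `shift^-∘` merges both into (D + c + c e)ᵐ
      -- (D + c)ⁱ.
      true-shift : ∀ m i → G (m ℕ.+ i) (true , m) ≈ shift^ (c + c * e) m (shift^ c i top) 0
      true-shift m i = begin
        G (m ℕ.+ i) (true , m)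
          ≈⟨ shift^-unique (c * e) (λ m i → G (m ℕ.+ i) (true , m)) (λ m i →
               trans (true-step (ℕ.m≤m+n m i))
                 (+-congʳ (reflexive (cong (λ n → G n (true , m)) (≡.sym (ℕ.+-suc m i)))))) m i ⟩
        shift^ (c * e) m (λ k → G k (true , 0)) i
          ≈⟨ shift^-cong m i refl (λ k → begin
               G k (true , 0)            ≈⟨ true≈false k ⟩
               G k (false , 0)           ≡⟨ cong (λ n → G n (false , 0)) (ℕ.+-identityʳ k) ⟨
               G (k ℕ.+ 0) (false , 0)   ≈⟨ false-shift k 0 ⟩
               shift^ c k top 0          ∎) ⟩
        shift^ (c * e) m (λ k → shift^ c k top 0) i
          ≈⟨ shift^-∘ c (c * e) top m i ⟩
        shift^ (c + c * e) m (shift^ c i top) 0 ∎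

      -- Every letter lies below the topmost gap and none below the lowest, so the comparison of the
      -- pivot with the first letter gives the factor x in one case and 1 in the other. Nothing else
      -- depends on the pivot.
      top-wraps : ∀ n → top (suc n) ≈ x * G (suc n) (true , suc n)
      top-wraps n = begin
        G (suc n) (false , suc n)     ≈⟨ step n (false , suc n) ⟩
        _                             ≈⟨ sum-cong-≋ {suc n} extreme ⟩
        ∑[ k ≤ n ] (x * (x ^ bit (below (true  , toℕ k) (true , suc n)) * (e * G n (true , toℕ k)) +
                          x ^ bit (below (false , toℕ k) (true , suc n)) * G n (false , toℕ k)))
                                      ≈⟨ *-distribˡ-sum {suc n} x (λ k →
                                          x ^ bit (below (true  , toℕ k) (true , suc n)) * (e * G n (true , toℕ k)) +
                                          x ^ bit (below (false , toℕ k) (true , suc n)) * G n (false , toℕ k)) ⟨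
        _                             ≈⟨ *-congˡ (step n (true , suc n)) ⟨
        x * G (suc n) (true , suc n)  ∎
        where
        extreme : ∀ (k : Fin (suc n)) →
          x ^ 1 * (e * G n (true , toℕ k)) + x ^ bit (toℕ k <ᵇ suc n) * G n (false , toℕ k) ≈
          x * (x ^ bit (not (toℕ k <ᵇ suc n)) * (e * G n (true , toℕ k)) + 1# * G n (false , toℕ k))
        extreme k rewrite <ᵇ-true (toℕ<n k) =
          solve 3 (λ x p q → x :* con 1 :* p :+ x :* con 1 :* q := x :* (con 1 :* p :+ con 1 :* q)) refl
            x (e * G n (true , toℕ k)) (G n (false , toℕ k))

      top-recurrence : ∀ n → top (suc n) ≈ x * shift^ (c + c * e) (suc n) top 0
      top-recurrence n = trans (top-wraps n) (*-congˡ (begin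
        G (suc n) (true , suc n)                   ≡⟨ cong (λ k → G k (true , suc n)) (ℕ.+-identityʳ (suc n)) ⟨
        G (suc n ℕ.+ 0) (true , suc n)             ≈⟨ true-shift (suc n) 0 ⟩
        shift^ (c + c * e) (suc n) top 0           ∎))

    -- In x (D + b)ⁿ⁺¹ the value at n + 1 has coefficient x and all other values come earlier. So
    -- the earlier values fix 1 - x = c times the value at n + 1, and c is invertible.
    recurrence-unique : ∀ b f g → f 0 ≈ g 0 →
      (∀ n → f (suc n) ≈ x * shift^ b (suc n) f 0) →
      (∀ n → g (suc n) ≈ x * shift^ b (suc n) g 0) →
      ∀ n → f n ≈ g n
    recurrence-unique b f g f₀≈g₀ f-rec g-rec n = below-n (suc n) n ℕ.≤-refl
      where
      next : ∀ n → (∀ k → k ℕ.< suc n → f k ≈ g k) → f (suc n) ≈ g (suc n)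
      next n f≈g = begin
        f (suc n)              ≈⟨ *-identityˡ _ ⟨
        1# * f (suc n)         ≈⟨ *-congʳ c⁻¹*c≈1 ⟨
        c⁻¹ * c * f (suc n)    ≈⟨ *-assoc _ _ _ ⟩
        -- Adding x f (n + 1) + x g (n + 1) completes c f (n + 1) to f (n + 1) and c g (n + 1) to g
        -- (n + 1), to which the recurrences apply.
        c⁻¹ * (c * f (suc n))  ≈⟨ *-congˡ (+-cancelʳ (x * f (suc n) + x * g (suc n)) _ _ (begin
          c * f (suc n) + (x * f (suc n) + x * g (suc n))
            ≈⟨ solve 4 (λ x c f g → c :* f :+ (x :* f :+ x :* g) := (x :* f :+ c :* f) :+ x :* g) refl x c _ _ ⟩
          (x * f (suc n) + c * f (suc n)) + x * g (suc n)
            ≈⟨ +-congʳ (trans (x*h+c*h _) (f-rec n)) ⟩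
          x * shift^ b (suc n) f 0 + x * g (suc n)
            ≈⟨ distribˡ x _ _ ⟨
          x * (shift^ b (suc n) f 0 + g (suc n))
            ≈⟨ *-congˡ (leading n f≈g) ⟩
          x * (shift^ b (suc n) g 0 + f (suc n))
            ≈⟨ distribˡ x _ _ ⟩
          x * shift^ b (suc n) g 0 + x * f (suc n)
            ≈⟨ +-congʳ (trans (x*h+c*h _) (g-rec n)) ⟨
          (x * g (suc n) + c * g (suc n)) + x * f (suc n)
            ≈⟨ solve 4 (λ x c f g → (x :* g :+ c :* g) :+ x :* f := c :* g :+ (x :* f :+ x :* g)) refl x c _ _ ⟩
          c * g (suc n) + (x * f (suc n) + x * g (suc n)) ∎)) ⟩
        c⁻¹ * (c * g (suc n))  ≈⟨ *-assoc _ _ _ ⟨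
        c⁻¹ * c * g (suc n)    ≈⟨ *-congʳ c⁻¹*c≈1 ⟩
        1# * g (suc n)         ≈⟨ *-identityˡ _ ⟩
        g (suc n)              ∎
        where
        leading : ∀ n → (∀ k → k ℕ.< suc n → f k ≈ g k) →
                  shift^ b (suc n) f 0 + g (suc n) ≈ shift^ b (suc n) g 0 + f (suc n)
        leading n f≈g = subst
          (λ k → (∀ i → i ℕ.< k → f i ≈ g i) → shift^ b (suc n) f 0 + g k ≈ shift^ b (suc n) g 0 + f k)
          (ℕ.+-identityʳ (suc n)) (shift^-leading b f g (suc n) 0) f≈g

      below-n : ∀ n k → k ℕ.< n → f k ≈ g k
      below-n (suc n) zero    _         = f₀≈g₀
      below-n (suc n) (suc k) (s≤s k<n) =
        next k λ i i≤k → below-n n i (ℕ.≤-trans i≤k k<n)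

    -- For e = 0 the recurrence reads Dⁿ = x (D + c)ⁿ. Scaling by r = 1 + e turns it into the
    -- recurrence of `G.top`, since r c = c + c e, and `recurrence-unique` concludes.
    top-scales : ∀ {e G H} (isG : GapRecurrence x e G) (isH : GapRecurrence x 0# H) →
                 ∀ n → G n (false , n) ≈ (1# + e) ^ n * H n (false , n)
    top-scales {e} {G} {H} isG isH = recurrence-unique (c + c * e) G.top scaled
      (trans (base isG _) (sym (trans (*-identityˡ _) (base isH _))))
      G.top-recurrence
      λ n → begin
        r ^ suc n * H.top (suc n)                            ≈⟨ *-congˡ (H.top-recurrence n) ⟩
        r ^ suc n * (x * shift^ (c + c * 0#) (suc n) H.top 0)
          ≈⟨ *-congˡ (*-congˡ (shift^-cong (suc n) 0
               (solve 1 (λ c → c :+ c :* con 0 := c) refl c) (λ _ → refl))) ⟩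
        r ^ suc n * (x * shift^ c (suc n) H.top 0)
          ≈⟨ solve 3 (λ p x s → p :* (x :* s) := x :* (p :* s)) refl (r ^ suc n) x _ ⟩
        x * (r ^ suc n * shift^ c (suc n) H.top 0)
          ≡⟨ cong (λ k → x * (r ^ k * shift^ c (suc n) H.top 0)) (ℕ.+-identityʳ (suc n)) ⟨
        x * (r ^ (suc n ℕ.+ 0) * shift^ c (suc n) H.top 0)
          ≈⟨ *-congˡ (shift^-scale r c H.top (suc n) 0) ⟨
        x * shift^ (r * c) (suc n) scaled 0
          ≈⟨ *-congˡ (shift^-cong (suc n) 0
               (solve 2 (λ c e → (con 1 :+ e) :* c := c :+ c :* e) refl c e) (λ _ → refl)) ⟩
        x * shift^ (c + c * e) (suc n) scaled 0              ∎
      where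
      open GapRecurrence
      module G = Gaps isG
      module H = Gaps isH
      r = 1# + e
      scaled : ℕ → Carrier
      scaled n = r ^ n * H.top n

    -- The centre is (D + c)ⁿ by `false-shift`. Its binomial expansion involves values of `G.top`,
    -- which `top-scales` expresses through H.
    centre-expands : ∀ {e G H} (isG : GapRecurrence x e G) (isH : GapRecurrence x 0# H) → ∀ n →
      G n (false , 0) ≈ ∑[ k ≤ n ] ((n C toℕ k) · ((1# + e) ^ toℕ k * c ^ (n ∸ toℕ k) * H (toℕ k) (false , toℕ k)))
    centre-expands {e} {G} {H} isG isH n = begin
      G n (false , 0)           ≡⟨ cong (λ k → G k (false , 0)) (ℕ.+-identityʳ n) ⟨
      G (n ℕ.+ 0) (false , 0)   ≈⟨ G.false-shift n 0 ⟩
      shift^ c n G.top 0        ≈⟨ shift^-binomial c G.top n 0 ⟩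
      ∑[ k ≤ n ] ((n C toℕ k) · (c ^ (n ∸ toℕ k) * G.top (toℕ k)))
        ≈⟨ sum-cong-≋ {suc n} (λ k → ×-congʳ (n C toℕ k) (begin
             c ^ (n ∸ toℕ k) * G.top (toℕ k)
               ≈⟨ *-congˡ (top-scales isG isH (toℕ k)) ⟩
             c ^ (n ∸ toℕ k) * ((1# + e) ^ toℕ k * H (toℕ k) (false , toℕ k))
               ≈⟨ solve 3 (λ p q h → p :* (q :* h) := q :* p :* h) refl _ _ _ ⟩
             (1# + e) ^ toℕ k * c ^ (n ∸ toℕ k) * H (toℕ k) (false , toℕ k) ∎)) ⟩
      ∑[ k ≤ n ] ((n C toℕ k) · ((1# + e) ^ toℕ k * c ^ (n ∸ toℕ k) * H (toℕ k) (false , toℕ k))) ∎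
      where module G = Gaps isG

-- Words of signed letters

Letter : ℕ → Set
Letter n = Bool Product.× Fin n

code : ∀ {n} → Letter n → Bool Product.× ℕ
code = map₂ toℕ

less : Bool Product.× ℕ → Bool Product.× ℕ → Bool
less (false , k) (false , j) = k <ᵇ j
less (true  , k) (true  , j) = j <ᵇ k
less (true  , _) (false , _) = true
less (false , _) (true  , _) = false

descents : ∀ {n m} → Letter n → Vec (Letter n) m → ℕ
descents l []       = 0
descents l (l′ ∷ w) = bit (less (code l′) (code l)) ℕ.+ descents l′ w

drops : ∀ {n m} → Gap → Vec (Letter n) m → ℕ
drops g []      = 0
drops g (l ∷ w) = bit (below (code l) g) ℕ.+ descents l w

negatives : ∀ {n m} → Vec (Letter n) m → ℕ
negatives []            = 0
negatives ((s , _) ∷ w) = bit s ℕ.+ negatives w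

lift : ∀ {n} → Fin (suc n) → Letter n → Letter (suc n)
lift k = map₂ (punchIn k)

-- Inverse to removing the first letter and standardizing: `punchIn` frees the absolute value of l.
insert : ∀ {n m} → Letter (suc n) → Vec (Letter n) m → Vec (Letter (suc n)) (suc m)
insert l w = l ∷ Vec.map (lift (proj₂ l)) w

-- The words with distinct absolute values and signs from `ss`, generated by first letter so that
-- the gap recurrence can be read off. The sign lists `both` and `false ∷ []` give the signed and
-- unsigned permutations.
arrange : List Bool → ∀ n → List (Vec (Letter n) n)
arrange ss zero    = [] ∷ []
arrange ss (suc n) = cartesianProductWith insert (cartesianProduct ss (allFin (suc n))) (arrange ss n)

punchIn-<ᵇ : ∀ {n} (k : Fin (suc n)) i j → (toℕ (punchIn k i) <ᵇ toℕ (punchIn k j)) ≡ (toℕ i <ᵇ toℕ j)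
punchIn-<ᵇ zero    i       j       = ≡.refl
punchIn-<ᵇ (suc k) zero    zero    = ≡.refl
punchIn-<ᵇ (suc k) zero    (suc j) = ≡.refl
punchIn-<ᵇ (suc k) (suc i) zero    = ≡.refl
punchIn-<ᵇ (suc k) (suc i) (suc j) = punchIn-<ᵇ k i j

punchIn-<ᵇ-pivot : ∀ {n} (k : Fin (suc n)) i → (toℕ (punchIn k i) <ᵇ toℕ k) ≡ (toℕ i <ᵇ toℕ k)
punchIn-<ᵇ-pivot zero    i       = ≡.refl
punchIn-<ᵇ-pivot (suc k) zero    = ≡.refl
punchIn-<ᵇ-pivot (suc k) (suc i) = punchIn-<ᵇ-pivot k i

pivot-<ᵇ-punchIn : ∀ {n} (k : Fin (suc n)) i → (toℕ k <ᵇ toℕ (punchIn k i)) ≡ not (toℕ i <ᵇ toℕ k)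
pivot-<ᵇ-punchIn zero    i       = ≡.refl
pivot-<ᵇ-punchIn (suc k) zero    = ≡.refl
pivot-<ᵇ-punchIn (suc k) (suc i) = pivot-<ᵇ-punchIn k i

less-lift : ∀ {n} k (l l′ : Letter n) → less (code (lift k l)) (code (lift k l′)) ≡ less (code l) (code l′)
less-lift k (false , i) (false , j) = punchIn-<ᵇ k i j
less-lift k (false , i) (true  , j) = ≡.refl
less-lift k (true  , i) (false , j) = ≡.refl
less-lift k (true  , i) (true  , j) = punchIn-<ᵇ k j i

-- Lifting opens a place for l exactly at the gap with the same code; this is why letters and gaps
-- share their codes.
less-pivot : ∀ {n} (l : Letter (suc n)) l′ → less (code (lift (proj₂ l) l′)) (code l) ≡ below (code l′) (code l)
less-pivot (false , k) (false , i) = punchIn-<ᵇ-pivot k i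
less-pivot (false , k) (true  , i) = ≡.refl
less-pivot (true  , k) (false , i) = ≡.refl
less-pivot (true  , k) (true  , i) = pivot-<ᵇ-punchIn k i

descents-lift : ∀ {n m} k (l : Letter n) (w : Vec (Letter n) m) →
                descents (lift k l) (Vec.map (lift k) w) ≡ descents l w
descents-lift k l []       = ≡.refl
descents-lift k l (l′ ∷ w) = cong₂ (λ b d → bit b ℕ.+ d) (less-lift k l′ l) (descents-lift k l′ w)

descents-insert : ∀ {n m} l (w : Vec (Letter n) m) →
                  descents l (Vec.map (lift (proj₂ l)) w) ≡ drops (code l) w
descents-insert l []       = ≡.refl
descents-insert l (l′ ∷ w) =
  cong₂ (λ b d → bit b ℕ.+ d) (less-pivot l l′) (descents-lift (proj₂ l) l′ w)

negatives-lift : ∀ {n m} k (w : Vec (Letter n) m) → negatives (Vec.map (lift k) w) ≡ negatives w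
negatives-lift k []            = ≡.refl
negatives-lift k ((s , _) ∷ w) = cong (bit s ℕ.+_) (negatives-lift k w)

-- Duplicate-free enumerations of words and permutations

vec-ext : ∀ {a n} {A : Set a} {v w : Vec A n} → (∀ i → lookup v i ≡ lookup w i) → v ≡ w
vec-ext {v = v} {w} v≗w =
  ≡.trans (≡.sym (tabulate∘lookup v)) (≡.trans (tabulate-cong v≗w) (tabulate∘lookup w))

map-injective : ∀ {a b n} {A : Set a} {B : Set b} {f : A → B} → Injective _≡_ _≡_ f →
                Injective _≡_ _≡_ (Vec.map {n = n} f)
map-injective {f = f} f-inj {v} {w} e = vec-ext λ i → f-inj
  (≡.trans (≡.sym (lookup-map i f v)) (≡.trans (cong (λ u → lookup u i) e) (lookup-map i f w)))

-- Pigeonhole: if j is missed, `punchOut` at j turns f into an injection of `Fin (suc n)` into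
-- `Fin n`.
injective⇒surjective : ∀ {n} {f : Fin n → Fin n} → Injective _≡_ _≡_ f → Surjective _≡_ _≡_ f
injective⇒surjective {suc n} {f} f-inj j with any? (λ i → f i Fin.≟ j)
... | yes (i , fi≡j) = i , λ { ≡.refl → fi≡j }
... | no  j∉f        = contradiction
  (injective⇒≤ λ {i} {k} e → f-inj (punchOut-injective (missed i) (missed k) e))
  ℕ.1+n≰n
  where
  missed : ∀ i → j ≢ f i
  missed i e = j∉f (i , ≡.sym e)

injective⇒permutation : ∀ {n} (π : Vec (Fin n) n) → Injective _≡_ _≡_ (lookup π) → IsPermutation π
injective⇒permutation π π-inj = π-inj , injective⇒surjective π-inj

∈-words : ∀ {m n} (w : Vec (Fin m) n) → w ∈ words m n
∈-words []      = here ≡.refl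
∈-words (i ∷ w) = ∈-cartesianProductWith⁺ Vec._∷_ (∈-allFin i) (∈-words w)

words-unique : ∀ m n → Unique (words m n)
words-unique m zero    = [] ∷ []
words-unique m (suc n) =
  Unique.cartesianProductWith⁺ Vec._∷_ ∷-injective (Unique.allFin⁺ m) (words-unique m n)

-- Without repetitions, membership determines a list up to order, which is all that a finite sum
-- depends on.
same-members⇒↭ : ∀ {a} {A : Set a} {xs ys : List A} → Unique xs → Unique ys →
                 (∀ {z} → z ∈ xs → z ∈ ys) → (∀ {z} → z ∈ ys → z ∈ xs) → xs ↭ ys
same-members⇒↭ xs! ys! xs⊆ys ys⊆xs = ∼bag⇒↭ (unique∧set⇒bag xs! ys! (mk⇔ xs⊆ys ys⊆xs))

abs : ∀ {n m} → Vec (Letter n) m → Fin m → Fin n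
abs w i = proj₂ (lookup w i)

lift-injective : ∀ {n} k → Injective _≡_ _≡_ (lift {n} k)
lift-injective k {s , i} {s′ , i′} e with ≡.refl , e′ ← ,-injective e =
  cong (s ,_) (punchIn-injective k i i′ e′)

insert-injective : ∀ {n m} {l l′} {w w′ : Vec (Letter n) m} →
                   insert l w ≡ insert l′ w′ → l ≡ l′ Product.× w ≡ w′
insert-injective e with ≡.refl , e′ ← ∷-injective e = ≡.refl , map-injective (lift-injective _) e′

arrange-unique : ∀ {ss} → Unique ss → ∀ n → Unique (arrange ss n)
arrange-unique ss! zero    = [] ∷ []
arrange-unique ss! (suc n) = Unique.cartesianProductWith⁺ insert insert-injective
  (Unique.cartesianProduct⁺ ss! (Unique.allFin⁺ (suc n))) (arrange-unique ss! n)

∈-arrange⁻ : ∀ ss n {w} → w ∈ arrange ss n →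
             (∀ i → proj₁ (lookup w i) ∈ ss) Product.× Injective _≡_ _≡_ (abs w)
∈-arrange⁻ ss zero    (here ≡.refl) = (λ ()) , λ { {()} }
∈-arrange⁻ ss (suc n) w∈
  with (s , k) , w , l∈ , w∈ , ≡.refl ← ∈-cartesianProductWith⁻ insert
         (cartesianProduct ss (allFin (suc n))) (arrange ss n) w∈
  with signs , abs-inj ← ∈-arrange⁻ ss n w∈ = signs′ , abs-inj′
  where
  lookup-lift : ∀ i → lookup (Vec.map (lift k) w) i ≡ lift k (lookup w i)
  lookup-lift i = lookup-map i (lift k) w

  signs′ : ∀ i → proj₁ (lookup (insert (s , k) w) i) ∈ ss
  signs′ zero    = proj₁ (∈-cartesianProduct⁻ ss (allFin (suc n)) l∈)
  signs′ (suc i) = subst (_∈ ss) (≡.sym (cong proj₁ (lookup-lift i))) (signs i)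

  abs-inj′ : Injective _≡_ _≡_ (abs (insert (s , k) w))
  abs-inj′ {zero}  {zero}  e = ≡.refl
  abs-inj′ {zero}  {suc j} e =
    contradiction (≡.sym (≡.trans e (cong proj₂ (lookup-lift j)))) (punchInᵢ≢i k (abs w j))
  abs-inj′ {suc i} {zero}  e =
    contradiction (≡.trans (≡.sym (cong proj₂ (lookup-lift i))) e) (punchInᵢ≢i k (abs w i))
  abs-inj′ {suc i} {suc j} e = cong suc (abs-inj (punchIn-injective k (abs w i) (abs w j)
    (≡.trans (≡.sym (cong proj₂ (lookup-lift i))) (≡.trans e (cong proj₂ (lookup-lift j))))))

-- The tail is standardized: none of its absolute values equals k, so `punchOut` can close the place
-- of k, and `insert` reopens it.
∈-arrange⁺ : ∀ ss n {w} → (∀ i → proj₁ (lookup w i) ∈ ss) → Injective _≡_ _≡_ (abs w) →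
             w ∈ arrange ss n
∈-arrange⁺ ss zero    {[]}    signs abs-inj = here ≡.refl
∈-arrange⁺ ss (suc n) {(s , k) ∷ w} signs abs-inj = subst (_∈ arrange ss (suc n)) insert-w′
  (∈-cartesianProductWith⁺ insert (∈-cartesianProduct⁺ (signs zero) (∈-allFin k))
    (∈-arrange⁺ ss n signs′ abs-inj′))
  where
  k≢ : ∀ i → k ≢ abs w i
  k≢ i e with () ← abs-inj {zero} {suc i} e

  shrink : Fin n → Letter n
  shrink i = proj₁ (lookup w i) , punchOut (k≢ i)

  w′ : Vec (Letter n) n
  w′ = tabulate shrink

  insert-w′ : insert (s , k) w′ ≡ (s , k) ∷ w
  insert-w′ = cong ((s , k) ∷_) (vec-ext λ i → ≡.trans (lookup-map i (lift k) w′)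
    (≡.trans (cong (lift k) (lookup∘tabulate shrink i))
           (cong (proj₁ (lookup w i) ,_) (punchIn-punchOut (k≢ i)))))

  signs′ : ∀ i → proj₁ (lookup w′ i) ∈ ss
  signs′ i = subst (_∈ ss) (≡.sym (cong proj₁ (lookup∘tabulate shrink i))) (signs (suc i))

  abs-inj′ : Injective _≡_ _≡_ (abs w′)
  abs-inj′ {i} {j} e = Fin.suc-injective (abs-inj {suc i} {suc j}
    (punchOut-injective (k≢ i) (k≢ j) (≡.trans (≡.sym (cong proj₂ (lookup∘tabulate shrink i)))
      (≡.trans e (cong proj₂ (lookup∘tabulate shrink j))))))

positive : ∀ {n m} → Vec (Fin n) m → Vec (Letter n) m
positive = Vec.map (false ,_)

lookup-positive : ∀ {n m} (π : Vec (Fin n) m) i → lookup (positive π) i ≡ (false , lookup π i)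
lookup-positive π i = lookup-map i (false ,_) π

𝔖↭arrange : ∀ n → List.map positive (𝔖 n) ↭ arrange (false ∷ []) n
𝔖↭arrange n = same-members⇒↭
  (Unique.map⁺ (map-injective λ { ≡.refl → ≡.refl }) (Unique.filter⁺ isPermutation? (words-unique n n)))
  (arrange-unique ([] ∷ []) n) to from
  where
  to : ∀ {w} → w ∈ List.map positive (𝔖 n) → w ∈ arrange (false ∷ []) n
  to w∈ with π , π∈ , ≡.refl ← ∈-map⁻ positive w∈
        with _ , π-inj , _ ← ∈-filter⁻ isPermutation? {xs = words n n} π∈ =
    ∈-arrange⁺ (false ∷ []) n (λ i → here (cong proj₁ (lookup-positive π i)))
      λ {i} {j} e → π-inj (≡.trans (≡.sym (cong proj₂ (lookup-positive π i)))
                            (≡.trans e (cong proj₂ (lookup-positive π j))))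

  from : ∀ {w} → w ∈ arrange (false ∷ []) n → w ∈ List.map positive (𝔖 n)
  from {w} w∈ with signs , abs-inj ← ∈-arrange⁻ (false ∷ []) n w∈ =
    subst (_∈ List.map positive (𝔖 n)) positive-π (∈-map⁺ positive
      (∈-filter⁺ isPermutation? (∈-words π) (injective⇒permutation π π-inj)))
    where
    π : Vec (Fin n) n
    π = tabulate (abs w)

    π-inj : Injective _≡_ _≡_ (lookup π)
    π-inj {i} {j} e =
      abs-inj (≡.trans (≡.sym (lookup∘tabulate (abs w) i)) (≡.trans e (lookup∘tabulate (abs w) j)))

    sign-false : ∀ {s} → s ∈ false ∷ [] → false ≡ s
    sign-false (here s≡false) = ≡.sym s≡false

    positive-π : positive π ≡ w
    positive-π = vec-ext λ i → ≡.trans (lookup-positive π i)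
      (cong₂ _,_ (sign-false (signs i)) (lookup∘tabulate (abs w) i))

-- Signed permutations

Word : ℕ → Set
Word n = Vec (Letter n) n

-- `nothing` is 0 and a letter is its signed value. In `± n` zero has position n and -(k + 1) has
-- position n - 1 - k, hence `opposite k`.
encode : ∀ n → Maybe (Letter n) → ± n
encode n nothing            = n ↑ʳ zero
encode n (just (false , k)) = n ↑ʳ suc k
encode n (just (true  , k)) = opposite k ↑ˡ suc n

decode : ∀ n → ± n → Maybe (Letter n)
decode n i with splitAt n i
... | inj₁ j       = just (true , opposite j)
... | inj₂ zero    = nothing
... | inj₂ (suc k) = just (false , k)

decode-encode : ∀ n m → decode n (encode n m) ≡ m
decode-encode n nothing            rewrite splitAt-↑ʳ n (suc n) zero = ≡.refl
decode-encode n (just (false , k)) rewrite splitAt-↑ʳ n (suc n) (suc k) = ≡.refl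
decode-encode n (just (true  , k)) rewrite splitAt-↑ˡ n (opposite k) (suc n) =
  cong (λ i → just (true , i)) (opposite-involutive k)

encode-decode : ∀ n i → encode n (decode n i) ≡ i
encode-decode n i with splitAt n i in e
... | inj₁ j       = ≡.trans (cong (_↑ˡ suc n) (opposite-involutive j)) (splitAt⁻¹-↑ˡ e)
... | inj₂ zero    = splitAt⁻¹-↑ʳ {n} e
... | inj₂ (suc k) = splitAt⁻¹-↑ʳ {n} e

encode-injective : ∀ n → Injective _≡_ _≡_ (encode n)
encode-injective n {m} {m′} e =
  ≡.trans (≡.sym (decode-encode n m)) (≡.trans (cong (decode n) e) (decode-encode n m′))

flip : ∀ {n} → Maybe (Letter n) → Maybe (Letter n)
flip = Maybe.map (map₁ not)

toℕ-opposite-↑ʳ : ∀ n (k : Fin (suc n)) → toℕ (opposite (n ↑ʳ k)) ≡ n ∸ toℕ k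
toℕ-opposite-↑ʳ n k = begin
  toℕ (opposite (n ↑ʳ k))                ≡⟨ opposite-prop (n ↑ʳ k) ⟩
  n ℕ.+ suc n ∸ suc (toℕ (n ↑ʳ k))       ≡⟨ cong₂ (λ p q → p ∸ suc q) (ℕ.+-suc n n) (toℕ-↑ʳ n k) ⟩
  n ℕ.+ n ∸ (n ℕ.+ toℕ k)                ≡⟨ ℕ.[m+n]∸[m+o]≡n∸o n n (toℕ k) ⟩
  n ∸ toℕ k                              ∎
  where open ≡.≡-Reasoning

toℕ-encode-true : ∀ n (k : Fin n) → toℕ (encode n (just (true , k))) ≡ n ∸ suc (toℕ k)
toℕ-encode-true n k = ≡.trans (toℕ-↑ˡ (opposite k) (suc n)) (opposite-prop k)

opposite-encode : ∀ n m → opposite (encode n m) ≡ encode n (flip m)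
opposite-encode n nothing            = toℕ-injective
  (≡.trans (toℕ-opposite-↑ʳ n zero) (≡.trans (≡.sym (ℕ.+-identityʳ n)) (≡.sym (toℕ-↑ʳ n zero))))
opposite-encode n (just (false , k)) = toℕ-injective
  (≡.trans (toℕ-opposite-↑ʳ n (suc k)) (≡.sym (toℕ-encode-true n k)))
opposite-encode n (just (true  , k)) =
  ≡.trans (cong opposite (≡.sym (opposite-encode n (just (false , k))))) (opposite-involutive (n ↑ʳ suc k))

decode-opposite : ∀ n i → decode n (opposite i) ≡ flip (decode n i)
decode-opposite n i = ≡.trans
  (cong (decode n) (≡.trans (cong opposite (≡.sym (encode-decode n i))) (opposite-encode n (decode n i))))
  (decode-encode n (flip (decode n i)))

-- Only 0 equals its negative; through this, oddness forces π₀ = 0.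
flip-fixed : ∀ {n} (m : Maybe (Letter n)) → flip m ≡ m → m ≡ nothing
flip-fixed nothing            _ = ≡.refl
flip-fixed (just (true  , _)) ()
flip-fixed (just (false , _)) ()

-- w is the window π₁⋯πₙ, extended to an odd map of {−n,…,n}; nothing stands for 0.
act : ∀ {n} → Word n → Maybe (Letter n) → Maybe (Letter n)
act w = Maybe.map λ { (s , i) → s xor proj₁ (lookup w i) , abs w i }

build : ∀ n → Word n → SignedWord n
build n w = tabulate λ i → encode n (act w (decode n i))

lookup-build : ∀ n w m → lookup (build n w) (encode n m) ≡ encode n (act w m)
lookup-build n w m = ≡.trans (lookup∘tabulate _ (encode n m))
  (cong (encode n ∘ act w) (decode-encode n m))

build-injective : ∀ n → Injective _≡_ _≡_ (build n)
build-injective n {w} {w′} e = vec-ext λ i → just-injective (encode-injective n (≡.trans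
  (≡.sym (lookup-build n w (just (false , i))))
  (≡.trans (cong (λ π → lookup π (n ↑ʳ suc i)) e) (lookup-build n w′ (just (false , i))))))

act-injective : ∀ {n} (w : Word n) → Injective _≡_ _≡_ (abs w) → Injective _≡_ _≡_ (act w)
act-injective w abs-inj {nothing}      {nothing}       e = ≡.refl
act-injective w abs-inj {just (s , i)} {just (s′ , i′)} e
  with es , ei ← ,-injective (just-injective e)
  with ≡.refl ← abs-inj ei = cong (λ b → just (b , i)) (xor-cancelʳ s s′ es)
  where
  xor-cancelʳ : ∀ {b} s s′ → s xor b ≡ s′ xor b → s ≡ s′
  xor-cancelʳ         true  true  _  = ≡.refl
  xor-cancelʳ         false false _  = ≡.refl
  xor-cancelʳ {true}  true  false ()
  xor-cancelʳ {false} true  false ()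
  xor-cancelʳ {true}  false true  ()
  xor-cancelʳ {false} false true  ()

act-flip : ∀ {n} (w : Word n) m → act w (flip m) ≡ flip (act w m)
act-flip w nothing            = ≡.refl
act-flip w (just (false , i)) = ≡.refl
act-flip w (just (true  , i)) =
  cong (λ s → just (s , abs w i)) (≡.sym (not-involutive (proj₁ (lookup w i))))

build-isSigned : ∀ n w → Injective _≡_ _≡_ (abs w) → IsSigned n (build n w)
build-isSigned n w abs-inj = injective⇒permutation (build n w) build-inj , build-odd
  where
  lookup′ : ∀ i → lookup (build n w) i ≡ encode n (act w (decode n i))
  lookup′ = lookup∘tabulate _

  build-inj : Injective _≡_ _≡_ (lookup (build n w))
  build-inj {i} {j} e = ≡.trans (≡.sym (encode-decode n i)) (≡.trans (cong (encode n)
    (act-injective w abs-inj {decode n i} {decode n j}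
      (encode-injective n (≡.trans (≡.sym (lookup′ i)) (≡.trans e (lookup′ j))))))
    (encode-decode n j))

  build-odd : ∀ i → lookup (build n w) (opposite i) ≡ opposite (lookup (build n w) i)
  build-odd i = begin
    lookup (build n w) (opposite i)          ≡⟨ lookup′ (opposite i) ⟩
    encode n (act w (decode n (opposite i))) ≡⟨ cong (encode n ∘ act w) (decode-opposite n i) ⟩
    encode n (act w (flip (decode n i)))     ≡⟨ cong (encode n) (act-flip w (decode n i)) ⟩
    encode n (flip (act w (decode n i)))     ≡⟨ opposite-encode n (act w (decode n i)) ⟨
    opposite (encode n (act w (decode n i))) ≡⟨ cong opposite (lookup′ i) ⟨
    opposite (lookup (build n w) i)          ∎
    where open ≡.≡-Reasoning

-- Oddness puts 0 at the centre, injectivity then makes every other value a letter, and oddness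
-- again recovers the negative half from the window w.
signed⇒build : ∀ n π → IsSigned n π → ∃ λ w → Injective _≡_ _≡_ (abs w) Product.× build n w ≡ π
signed⇒build n π ((π-inj , _) , odd) = w , abs-inj , vec-ext built
  where
  π[_] : Maybe (Letter n) → ± n
  π[ m ] = lookup π (encode n m)

  π[flip] : ∀ m → π[ flip m ] ≡ opposite π[ m ]
  π[flip] m = ≡.trans (cong (lookup π) (≡.sym (opposite-encode n m))) (odd (encode n m))

  π[]-injective : Injective _≡_ _≡_ π[_]
  π[]-injective e = encode-injective n (π-inj e)

  centre : π[ nothing ] ≡ encode n nothing
  centre = ≡.trans (≡.sym (encode-decode n π[ nothing ])) (cong (encode n)
    (flip-fixed (decode n π[ nothing ])
      (≡.trans (≡.sym (decode-opposite n π[ nothing ])) (cong (decode n) (≡.sym (π[flip] nothing))))))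

  letter : ∀ i → ∃ λ l → π[ just (false , i) ] ≡ encode n (just l)
  letter i with decode n π[ just (false , i) ] in e
  ... | just l  = l , ≡.trans (≡.sym (encode-decode n _)) (cong (encode n) e)
  -- The value 0 is already taken at the centre.
  ... | nothing with () ← π[]-injective {just (false , i)} {nothing}
                 (≡.trans (≡.sym (encode-decode n _)) (≡.trans (cong (encode n) e) (≡.sym centre)))

  w : Word n
  w = tabulate (proj₁ ∘ letter)

  π[false] : ∀ i → π[ just (false , i) ] ≡ encode n (just (lookup w i))
  π[false] i = ≡.trans (proj₂ (letter i)) (cong (encode n ∘ just) (≡.sym (lookup∘tabulate _ i)))

  π[true] : ∀ i → π[ just (true , i) ] ≡ encode n (flip (just (lookup w i)))
  π[true] i = ≡.trans (π[flip] (just (false , i)))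
    (≡.trans (cong opposite (π[false] i)) (opposite-encode n (just (lookup w i))))

  abs-inj : Injective _≡_ _≡_ (abs w)
  abs-inj {i} {j} e with lookup w i in wi | lookup w j in wj
  abs-inj {i} {j} ≡.refl | s , k | s′ , _ with s Bool.≟ s′
  -- Equal signs give π the same value at i and j, so i = j. Opposite signs would give it the same
  -- value at i and -j.
  ... | yes ≡.refl with ≡.refl ← π[]-injective {just (false , i)} {just (false , j)}
          (≡.trans (π[false] i)
            (≡.trans (cong (encode n ∘ just) (≡.trans wi (≡.sym wj))) (≡.sym (π[false] j)))) = ≡.refl
  ... | no s≢s′ with () ← π[]-injective {just (false , i)} {just (true , j)}
          (≡.trans (π[false] i) (≡.trans (cong (encode n ∘ just)
            (≡.trans wi (≡.trans (cong (_, k) (¬-not s≢s′)) (cong (map₁ not) (≡.sym wj))))) (≡.sym (π[true] j))))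

  encoded : ∀ m → encode n (act w m) ≡ π[ m ]
  encoded nothing            = ≡.sym centre
  encoded (just (false , i)) = ≡.sym (π[false] i)
  encoded (just (true  , i)) = ≡.sym (π[true] i)

  built : ∀ i → lookup (build n w) i ≡ lookup π i
  built i = ≡.trans (lookup∘tabulate _ i) (≡.trans (encoded (decode n i)) (cong (lookup π) (encode-decode n i)))

both : List Bool
both = true ∷ false ∷ []

𝔅↭arrange : ∀ n → 𝔅 n ↭ List.map (build n) (arrange both n)
𝔅↭arrange n = same-members⇒↭
  (Unique.filter⁺ (isSigned? n) (words-unique (n ℕ.+ suc n) (n ℕ.+ suc n)))
  (Unique.map⁺ (build-injective n) (arrange-unique (((λ ()) ∷ []) ∷ [] ∷ []) n)) to from
  where
  to : ∀ {π} → π ∈ 𝔅 n → π ∈ List.map (build n) (arrange both n)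
  to {π} π∈
    with _ , signed ← ∈-filter⁻ (isSigned? n) {xs = words (n ℕ.+ suc n) (n ℕ.+ suc n)} π∈
    with w , abs-inj , ≡.refl ← signed⇒build n π signed =
    ∈-map⁺ (build n) (∈-arrange⁺ both n {w} (λ i → ∈-both (proj₁ (lookup w i))) abs-inj)
    where
    ∈-both : ∀ s → s ∈ both
    ∈-both true  = here ≡.refl
    ∈-both false = there (here ≡.refl)

  from : ∀ {π} → π ∈ List.map (build n) (arrange both n) → π ∈ 𝔅 n
  from π∈ with w , w∈ , ≡.refl ← ∈-map⁻ (build n) π∈ =
    ∈-filter⁺ (isSigned? n) (∈-words (build n w)) (build-isSigned n w (proj₂ (∈-arrange⁻ both n w∈)))

-- Statistics

-- A count that recurses on positions, in step with `descents` and `negatives` along a word.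
tally : ∀ {n} → (Fin n → Bool) → ℕ
tally {zero}  b = 0
tally {suc n} b = bit (b zero) ℕ.+ tally (b ∘ suc)

tally-cong : ∀ {n} {b b′ : Fin n → Bool} → (∀ i → b i ≡ b′ i) → tally b ≡ tally b′
tally-cong {zero}  b≗b′ = ≡.refl
tally-cong {suc n} b≗b′ = cong₂ (λ p q → bit p ℕ.+ q) (b≗b′ zero) (tally-cong (b≗b′ ∘ suc))

length-filter-tabulate : ∀ {a p n} {A : Set a} {P : A → Set p} (P? : Decidable P) (f : Fin n → A) →
                         length (filter P? (List.tabulate f)) ≡ tally (does ∘ P? ∘ f)
length-filter-tabulate {n = zero}  P? f = ≡.refl
length-filter-tabulate {n = suc n} P? f with does (P? (f zero))
... | true  = cong suc (length-filter-tabulate P? (f ∘ suc))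
... | false = length-filter-tabulate P? (f ∘ suc)

count≡tally : ∀ {n p} {P : Fin n → Set p} (P? : Decidable P) → count P? ≡ tally (does ∘ P?)
count≡tally P? = length-filter-tabulate P? id

tally-descents : ∀ {n m} (l : Letter n) (w : Vec (Letter n) m) →
  tally (λ i → less (code (lookup w i)) (code (lookup (l ∷ w) (inject₁ i)))) ≡ descents l w
tally-descents l []       = ≡.refl
tally-descents l (l′ ∷ w) = cong (bit (less (code l′) (code l)) ℕ.+_) (tally-descents l′ w)

tally-negatives : ∀ {n m} (w : Vec (Letter n) m) → tally (λ i → proj₁ (lookup w i)) ≡ negatives w
tally-negatives []            = ≡.refl
tally-negatives ((s , _) ∷ w) = cong (bit s ℕ.+_) (tally-negatives w)

-- The gap `(false , suc n)` lies above every letter, so the pivot contributes one drop: the extra 1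
-- in the exponents of the Eulerian polynomial.
des-positive : ∀ {n} (π : Vec (Fin (suc n)) (suc n)) →
               des π ℕ.+ 1 ≡ drops (false , suc n) (positive π)
des-positive {n} π@(k ∷ π′) rewrite <ᵇ-true (toℕ<n k) = ≡.trans (ℕ.+-comm (des π) 1) (cong suc (begin
  des π
    ≡⟨ count≡tally (λ i → lookup π (suc i) Fin.<? lookup π (inject₁ i)) ⟩
  tally (λ i → toℕ (lookup π (suc i)) <ᵇ toℕ (lookup π (inject₁ i)))
    ≡⟨ tally-cong (λ i → cong₂ (λ l l′ → less (code l) (code l′))
         (lookup-positive π (suc i)) (lookup-positive π (inject₁ i))) ⟨
  tally (λ i → less (code (lookup (positive π′) i)) (code (lookup (positive π) (inject₁ i))))
    ≡⟨ tally-descents (false , k) (positive π′) ⟩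
  descents (false , k) (positive π′) ∎))
  where open ≡.≡-Reasoning

<ᵇ-cong : ∀ {m n p q} → (m ℕ.< n → p ℕ.< q) → (p ℕ.< q → m ℕ.< n) → (m <ᵇ n) ≡ (p <ᵇ q)
<ᵇ-cong {m} {n} {p} {q} to from = does-⇔ (mk⇔ to from) (m ℕ.<? n) (p ℕ.<? q)

value : ∀ n → Maybe (Letter n) → ℕ
value n m = toℕ (encode n m)

value-compare : ∀ n (l l′ : Letter n) → (value n (just l) <ᵇ value n (just l′)) ≡ less (code l) (code l′)
value-compare n (false , i) (false , j) rewrite toℕ-↑ʳ n (suc i) | toℕ-↑ʳ n (suc j) =
  <ᵇ-cong (ℕ.s<s⁻¹ ∘ ℕ.+-cancelˡ-< n _ _) (ℕ.+-monoʳ-< n ∘ s≤s)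
value-compare n (true , i) (true , j) rewrite toℕ-encode-true n i | toℕ-encode-true n j =
  <ᵇ-cong (ℕ.s<s⁻¹ ∘ λ lt → ℕ.≰⇒> λ le → ℕ.<⇒≱ lt (ℕ.∸-monoʳ-≤ n le))
          (λ lt → ℕ.∸-monoʳ-< (s≤s lt) (toℕ<n i))
value-compare n (true , i) (false , j) rewrite toℕ-encode-true n i | toℕ-↑ʳ n (suc j) =
  <ᵇ-true (ℕ.≤-<-trans (ℕ.m∸n≤m n (suc (toℕ i))) (ℕ.m<m+n n ℕ.z<s))
value-compare n (false , i) (true , j) rewrite toℕ-encode-true n j | toℕ-↑ʳ n (suc i) =
  <ᵇ-false (ℕ.≤-trans (ℕ.m∸n≤m n (suc (toℕ j))) (ℕ.m≤m+n n (suc (toℕ i))))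

value-sign : ∀ n (l : Letter n) → (value n (just l) <ᵇ value n nothing) ≡ proj₁ l
value-sign n (false , i) rewrite toℕ-↑ʳ n (suc i) | toℕ-↑ʳ n (zero {n}) =
  <ᵇ-false (ℕ.+-monoʳ-≤ n z≤n)
value-sign n@(suc n′) (true , i) rewrite toℕ-encode-true n i | toℕ-↑ʳ n (zero {n}) =
  <ᵇ-true (s≤s (ℕ.≤-trans (ℕ.m∸n≤m n′ (toℕ i)) (ℕ.m≤m+n n′ 0)))

neg-build : ∀ n w → neg n (build n w) ≡ negatives w
neg-build n w = begin
  neg n (build n w)
    ≡⟨ count≡tally (λ i → lookup (build n w) (n ↑ʳ suc i) Fin.<? n ↑ʳ zero {n}) ⟩
  tally (λ i → toℕ (lookup (build n w) (n ↑ʳ suc i)) <ᵇ value n nothing)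
    ≡⟨ tally-cong (λ i → ≡.trans
         (cong (λ v → toℕ v <ᵇ value n nothing) (lookup-build n w (just (false , i))))
         (value-sign n (lookup w i))) ⟩
  tally (λ i → proj₁ (lookup w i))
    ≡⟨ tally-negatives w ⟩
  negatives w ∎
  where open ≡.≡-Reasoning

-- The index 0 compares the first letter with π₀ = 0 and so records its sign; the other indices
-- compare neighbours in the window.
desB-build : ∀ {n} (l : Letter (suc n)) w →
             desB (suc n) (build (suc n) (l ∷ w)) ≡ bit (proj₁ l) ℕ.+ descents l w
desB-build {n} l w = begin
  desB (suc n) π
    ≡⟨ count≡tally (λ i → lookup π (suc n ↑ʳ suc i) Fin.<? lookup π (suc n ↑ʳ inject₁ i)) ⟩
  bit (toℕ (lookup π (encode (suc n) (just (false , zero)))) <ᵇ toℕ (lookup π (encode (suc n) nothing))) ℕ.+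
  tally (λ i → toℕ (lookup π (encode (suc n) (just (false , suc i)))) <ᵇ
               toℕ (lookup π (encode (suc n) (just (false , inject₁ i)))))
    ≡⟨ cong₂ ℕ._+_
         (cong bit (≡.trans (compare (just (false , zero)) nothing) (value-sign (suc n) l)))
         (tally-cong λ i → ≡.trans (compare (just (false , suc i)) (just (false , inject₁ i)))
           (value-compare (suc n) (lookup w i) (lookup (l ∷ w) (inject₁ i)))) ⟩
  bit (proj₁ l) ℕ.+ tally (λ i → less (code (lookup w i)) (code (lookup (l ∷ w) (inject₁ i))))
    ≡⟨ cong (bit (proj₁ l) ℕ.+_) (tally-descents l w) ⟩
  bit (proj₁ l) ℕ.+ descents l w ∎
  where
  open ≡.≡-Reasoning
  π = build (suc n) (l ∷ w)
  compare : ∀ m m′ →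
    (toℕ (lookup π (encode (suc n) m)) <ᵇ toℕ (lookup π (encode (suc n) m′))) ≡
    (value (suc n) (act (l ∷ w) m) <ᵇ value (suc n) (act (l ∷ w) m′))
  compare m m′ = cong₂ (λ p q → toℕ p <ᵇ toℕ q)
    (lookup-build (suc n) (l ∷ w) m) (lookup-build (suc n) (l ∷ w) m′)

-- A negative first letter adds 1 to `desB`, and 2 (1 + d) - 1 = 1 + 2 d, so one formula covers both
-- signs.
fdes-build : ∀ {n} (l : Letter (suc n)) w →
             fdes (suc n) (build (suc n) (l ∷ w)) ≡ bit (proj₁ l) ℕ.+ 2 ℕ.* descents l w
fdes-build {n} l w
  rewrite desB-build l w
        | ≡.trans (cong (λ v → toℕ v <ᵇ value (suc n) nothing)
                    (lookup-build (suc n) (l ∷ w) (just (false , zero))))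
                  (value-sign (suc n) l) = halve (proj₁ l)
  where
  d = descents l w
  halve : ∀ s → (if s then 2 ℕ.* (bit s ℕ.+ d) ∸ 1 else 2 ℕ.* (bit s ℕ.+ d)) ≡ bit s ℕ.+ 2 ℕ.* d
  -- Here `2 ℕ.* (1 ℕ.+ d) ∸ 1` computes to `d ℕ.+ suc (d ℕ.+ 0)`.
  halve true  = ℕ.+-suc d (d ℕ.+ 0)
  halve false = ≡.refl

drops-centre : ∀ {n m} (l : Letter n) (w : Vec (Letter n) m) →
               drops (false , 0) (l ∷ w) ≡ bit (proj₁ l) ℕ.+ descents l w
drops-centre (true  , _) w = ≡.refl
drops-centre (false , _) w = ≡.refl

drops-top : ∀ {n m} (l : Letter n) (w : Vec (Letter n) m) →
            drops (false , n) (l ∷ w) ≡ suc (descents l w)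
drops-top (true  , _) w = ≡.refl
drops-top (false , k) w rewrite <ᵇ-true (toℕ<n k) = ≡.refl

-- Enumerators

module Enumeration {a ℓ} (R : CommutativeRing a ℓ) where
  open CommutativeRing R hiding (zero)
  open Algebra.Properties.Semiring.Exp semiring using (_^_; ^-homo-*; ^-assocʳ)
  open Algebra.Properties.Semiring.Mult semiring using (×-congʳ) renaming (_×_ to _·_)
  open Algebra.Properties.Semiring.Sum semiring using (sum; sum-cong-≋; ∑-distrib-+; sum⁺-syntax)
  open Algebra.Solver.Ring.NaturalCoefficients.Default commutativeSemiring
    using (solve; _:=_; _:+_; _:*_; con)
  open Relation.Binary.Reasoning.Setoid setoid
  open Enumerators R
  open Umbral R

  ∑-cong : ∀ {i} {I : Set i} (xs : List I) {f g : I → Carrier} →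
           (∀ x → f x ≈ g x) → ∑[ xs ] f ≈ ∑[ xs ] g
  ∑-cong []       f≈g = refl
  ∑-cong (x ∷ xs) f≈g = +-cong (f≈g x) (∑-cong xs f≈g)

  ∑-+ : ∀ {i} {I : Set i} (xs : List I) (f g : I → Carrier) →
        ∑[ xs ] (λ x → f x + g x) ≈ ∑[ xs ] f + ∑[ xs ] g
  ∑-+ []       f g = sym (+-identityʳ 0#)
  ∑-+ (x ∷ xs) f g = trans (+-congˡ (∑-+ xs f g))
    (solve 4 (λ p q r s → (p :+ q) :+ (r :+ s) := (p :+ r) :+ (q :+ s)) refl (f x) (g x) _ _)

  ∑-*ˡ : ∀ {i} {I : Set i} (xs : List I) b (f : I → Carrier) →
         ∑[ xs ] (λ x → b * f x) ≈ b * ∑[ xs ] f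
  ∑-*ˡ []       b f = sym (zeroʳ b)
  ∑-*ˡ (x ∷ xs) b f = trans (+-congˡ (∑-*ˡ xs b f)) (sym (distribˡ b (f x) _))

  ∑-++ : ∀ {i} {I : Set i} (xs ys : List I) (f : I → Carrier) →
         ∑[ xs ++ ys ] f ≈ ∑[ xs ] f + ∑[ ys ] f
  ∑-++ []       ys f = sym (+-identityˡ _)
  ∑-++ (x ∷ xs) ys f = trans (+-congˡ (∑-++ xs ys f)) (sym (+-assoc _ _ _))

  ∑-map : ∀ {i j} {I : Set i} {J : Set j} (h : I → J) xs (f : J → Carrier) →
          ∑[ List.map h xs ] f ≈ ∑[ xs ] (f ∘ h)
  ∑-map h []       f = refl
  ∑-map h (x ∷ xs) f = +-congˡ (∑-map h xs f)

  ∑-product : ∀ {i j k} {I : Set i} {J : Set j} {K : Set k} (h : I → J → K) xs ys (f : K → Carrier) →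
              ∑[ cartesianProductWith h xs ys ] f ≈ ∑[ xs ] λ x → ∑[ ys ] λ y → f (h x y)
  ∑-product h []       ys f = refl
  ∑-product h (x ∷ xs) ys f =
    trans (∑-++ (List.map (h x) ys) _ f) (+-cong (∑-map (h x) ys f) (∑-product h xs ys f))

  ∑-tabulate : ∀ {i n} {I : Set i} (h : Fin n → I) (f : I → Carrier) →
               ∑[ List.tabulate h ] f ≈ sum (f ∘ h)
  ∑-tabulate {n = zero}  h f = refl
  ∑-tabulate {n = suc n} h f = +-congˡ (∑-tabulate (h ∘ suc) f)

  ∑-↭ : ∀ {i} {I : Set i} {xs ys : List I} (f : I → Carrier) → xs ↭ ys → ∑[ xs ] f ≈ ∑[ ys ] f
  ∑-↭ f ↭.refl          = refl
  ∑-↭ f (prep x p)        = +-congˡ (∑-↭ f p)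
  ∑-↭ f (swap x y p)      = trans (+-congˡ (+-congˡ (∑-↭ f p)))
    (solve 3 (λ p q r → p :+ (q :+ r) := q :+ (p :+ r)) refl (f x) (f y) _)
  ∑-↭ f (↭.trans p q)   = trans (∑-↭ f p) (∑-↭ f q)

  -- Gap sums over arrangements

  module _ (y x : Carrier) where

    weight : ∀ {n m} → Gap → Vec (Letter n) m → Carrier
    weight g w = y ^ negatives w * x ^ drops g w

    gapSum : List Bool → ℕ → Gap → Carrier
    gapSum ss n g = ∑[ arrange ss n ] (weight g)

    -- Only the comparison of the pivot with l involves g; after that l itself is the pivot, in the
    -- gap of its own code.
    weight-insert : ∀ {n m} g (l : Letter (suc n)) (w : Vec (Letter n) m) →
      weight g (insert l w) ≈ x ^ bit (below (code l) g) * (y ^ bit (proj₁ l) * weight (code l) w)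
    weight-insert g l w = begin
      y ^ (bit (proj₁ l) ℕ.+ negatives (Vec.map (lift (proj₂ l)) w)) *
      x ^ (bit (below (code l) g) ℕ.+ descents l (Vec.map (lift (proj₂ l)) w))
        ≡⟨ cong₂ (λ p q → y ^ (bit (proj₁ l) ℕ.+ p) * x ^ (bit (below (code l) g) ℕ.+ q))
             (negatives-lift (proj₂ l) w) (descents-insert l w) ⟩
      y ^ (bit (proj₁ l) ℕ.+ negatives w) * x ^ (bit (below (code l) g) ℕ.+ drops (code l) w)
        ≈⟨ *-cong (^-homo-* y (bit (proj₁ l)) (negatives w))
                  (^-homo-* x (bit (below (code l) g)) (drops (code l) w)) ⟩
      (y ^ bit (proj₁ l) * y ^ negatives w) * (x ^ bit (below (code l) g) * x ^ drops (code l) w)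
        ≈⟨ solve 4 (λ p q r s → (p :* q) :* (r :* s) := r :* (p :* (q :* s))) refl _ _ _ _ ⟩
      x ^ bit (below (code l) g) * (y ^ bit (proj₁ l) * weight (code l) w) ∎

    gapSum-step : ∀ ss n g → gapSum ss (suc n) g ≈ ∑[ ss ] λ s → ∑[ k ≤ n ]
      (x ^ bit (below (s , toℕ k) g) * (y ^ bit s * gapSum ss n (s , toℕ k)))
    gapSum-step ss n g = begin
      gapSum ss (suc n) g
        ≈⟨ ∑-product insert (cartesianProduct ss (allFin (suc n))) (arrange ss n) (weight g) ⟩
      (∑[ cartesianProduct ss (allFin (suc n)) ] λ l → ∑[ arrange ss n ] λ w → weight g (insert l w))
        ≈⟨ ∑-cong (cartesianProduct ss (allFin (suc n))) (λ l → trans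
             (∑-cong (arrange ss n) (weight-insert g l))
             (trans (∑-*ˡ (arrange ss n) _ _) (*-congˡ (∑-*ˡ (arrange ss n) _ _)))) ⟩
      (∑[ cartesianProduct ss (allFin (suc n)) ] term)
        ≈⟨ ∑-product _,_ ss (allFin (suc n)) term ⟩
      (∑[ ss ] λ s → ∑[ allFin (suc n) ] λ k → term (s , k))
        ≈⟨ ∑-cong ss (λ s → ∑-tabulate id (λ k → term (s , k))) ⟩
      (∑[ ss ] λ s → ∑[ k ≤ n ] term (s , k)) ∎
      where
      term : Letter (suc n) → Carrier
      term l = x ^ bit (below (code l) g) * (y ^ bit (proj₁ l) * gapSum ss n (code l))

    both-gaps : GapRecurrence x y (gapSum both)
    both-gaps = record
      { base = λ g → solve 0 (con 1 :* con 1 :+ con 0 := con 1) refl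
      ; step = λ n g → begin
          gapSum both (suc n) g
            ≈⟨ gapSum-step both n g ⟩
          sum (negative n g) + (sum (nonnegative n g) + 0#)
            ≈⟨ +-congˡ (+-identityʳ _) ⟩
          sum (negative n g) + sum (nonnegative n g)
            ≈⟨ ∑-distrib-+ (negative n g) (nonnegative n g) ⟨
          sum (λ k → negative n g k + nonnegative n g k)
            ≈⟨ sum-cong-≋ {suc n} (λ k → +-cong
                 (*-congˡ {jump n g true k} (*-congʳ {gapSum both n (true , toℕ k)} (*-identityʳ y)))
                 (*-congˡ {jump n g false k} (*-identityˡ (gapSum both n (false , toℕ k))))) ⟩
          _ ∎
      }
      where
      jump : ∀ n → Gap → Bool → Fin (suc n) → Carrier
      jump n g s k = x ^ bit (below (s , toℕ k) g)
      negative nonnegative : ∀ n → Gap → Fin (suc n) → Carrier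
      negative    n g k = jump n g true k * (y * 1# * gapSum both n (true  , toℕ k))
      nonnegative n g k = jump n g false k * (1# * gapSum both n (false , toℕ k))

    -- `step` asks for a summand of either sign; the negative one is supplied with the factor 0#.
    positive-gaps : GapRecurrence x 0# (gapSum (false ∷ []))
    positive-gaps = record
      { base = λ g → solve 0 (con 1 :* con 1 :+ con 0 := con 1) refl
      ; step = λ n g → begin
          gapSum (false ∷ []) (suc n) g
            ≈⟨ trans (gapSum-step (false ∷ []) n g) (+-identityʳ _) ⟩
          ∑[ k ≤ n ] (x ^ bit (below (false , toℕ k) g) * (1# * gapSum (false ∷ []) n (false , toℕ k)))
            ≈⟨ sum-cong-≋ {suc n} (λ k →
                 solve 4 (λ p q r s → p :* (con 1 :* q) := r :* (con 0 :* s) :+ p :* q) refl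
                   (x ^ bit (below (false , toℕ k) g)) (gapSum (false ∷ []) n (false , toℕ k))
                   (x ^ bit (below (true , toℕ k) g)) (gapSum (false ∷ []) n (true , toℕ k))) ⟩
          _ ∎
      }

    -- For n ≥ 1 the exponent des + 1 counts the drops from the topmost gap, and positive words
    -- carry y to the power 0. At n = 0 the convention A₀ = 1 matches the empty word, which has no
    -- drops.
    A≈top : ∀ n → A n x ≈ gapSum (false ∷ []) n (false , n)
    A≈top zero      = solve 0 (con 1 := con 1 :* con 1 :+ con 0) refl
    A≈top n@(suc _) = begin
      (∑[ 𝔖 n ] λ π → x ^ (des π ℕ.+ 1))
        ≈⟨ ∑-cong (𝔖 n) (λ π → begin
             x ^ (des π ℕ.+ 1)                        ≡⟨ cong (x ^_) (des-positive π) ⟩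
             x ^ drops (false , n) (positive π)       ≈⟨ *-identityˡ _ ⟨
             1# * x ^ drops (false , n) (positive π)
               ≡⟨ cong (λ k → y ^ k * x ^ drops (false , n) (positive π)) (negatives-positive π) ⟨
             weight (false , n) (positive π)          ∎) ⟩
      (∑[ 𝔖 n ] λ π → weight (false , n) (positive π))
        ≈⟨ ∑-map positive (𝔖 n) (weight (false , n)) ⟨
      ∑[ List.map positive (𝔖 n) ] (weight (false , n))
        ≈⟨ ∑-↭ (weight (false , n)) (𝔖↭arrange n) ⟩
      gapSum (false ∷ []) n (false , n) ∎
      where
      negatives-positive : ∀ {n m} (π : Vec (Fin n) m) → negatives (positive π) ≡ 0
      negatives-positive []      = ≡.refl
      negatives-positive (_ ∷ π) = negatives-positive π

  -- The identity holds word by word. If the first letter has sign bit s and d descents follow, fdes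
  -- is s + 2 d, and with x = t² both values of s satisfy t (1 + t) t^(s + 2 d) = x^(d + 1) + t x^(s
  -- + d). The exponents of x count the drops from the topmost gap and from 0.
  F≈gaps : ∀ n y t → t * (1# + t) * F (suc n) y t ≈
           gapSum y (t ^ 2) both (suc n) (false , suc n) + t * gapSum y (t ^ 2) both (suc n) (false , 0)
  F≈gaps n′ y t = begin
    t * (1# + t) * F n y t
      ≈⟨ *-congˡ (trans (∑-↭ (λ π → y ^ neg n π * t ^ fdes n π) (𝔅↭arrange n)) (∑-map (build n) ws _)) ⟩
    t * (1# + t) * (∑[ ws ] λ w → y ^ neg n (build n w) * t ^ fdes n (build n w))
      ≈⟨ ∑-*ˡ ws _ _ ⟨
    (∑[ ws ] λ w → t * (1# + t) * (y ^ neg n (build n w) * t ^ fdes n (build n w)))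
      ≈⟨ ∑-cong ws pointwise ⟩
    (∑[ ws ] λ w → weight y (t ^ 2) (false , n) w + t * weight y (t ^ 2) (false , 0) w)
      ≈⟨ trans (∑-+ ws _ _) (+-congˡ (∑-*ˡ ws t _)) ⟩
    gapSum y (t ^ 2) both n (false , n) + t * gapSum y (t ^ 2) both n (false , 0) ∎
    where
    n = suc n′
    ws = arrange both n

    pointwise : ∀ w → t * (1# + t) * (y ^ neg n (build n w) * t ^ fdes n (build n w)) ≈
                      weight y (t ^ 2) (false , n) w + t * weight y (t ^ 2) (false , 0) w
    pointwise w@(l ∷ w′) rewrite neg-build n w | fdes-build l w′ | drops-top l w′ | drops-centre l w′ = begin
      t * (1# + t) * (N * t ^ (bit (proj₁ l) ℕ.+ 2 ℕ.* d))
        ≈⟨ *-congˡ (*-congˡ (trans (^-homo-* t (bit (proj₁ l)) (2 ℕ.* d))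
             (*-congˡ (sym (^-assocʳ t 2 d))))) ⟩
      t * (1# + t) * (N * (t ^ bit (proj₁ l) * (t ^ 2) ^ d))
        ≈⟨ by-sign (proj₁ l) ⟩
      N * (t ^ 2) ^ suc d + t * (N * ((t ^ 2) ^ bit (proj₁ l) * (t ^ 2) ^ d))
        ≈⟨ +-congˡ (*-congˡ (*-congˡ (^-homo-* (t ^ 2) (bit (proj₁ l)) d))) ⟨
      N * (t ^ 2) ^ suc d + t * (N * (t ^ 2) ^ (bit (proj₁ l) ℕ.+ d)) ∎
      where
      N = y ^ negatives w
      d = descents l w′
      by-sign : ∀ s → t * (1# + t) * (N * (t ^ bit s * (t ^ 2) ^ d)) ≈
                      N * (t ^ 2) ^ suc d + t * (N * ((t ^ 2) ^ bit s * (t ^ 2) ^ d))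
      by-sign true  = solve 3 (λ t N e → t :* (con 1 :+ t) :* (N :* (t :* con 1 :* e))
        := N :* (t :* (t :* con 1) :* e) :+ t :* (N :* (t :* (t :* con 1) :* con 1 :* e))) refl t N _
      by-sign false = solve 3 (λ t N e → t :* (con 1 :+ t) :* (N :* (con 1 :* e))
        := N :* (t :* (t :* con 1) :* e) :+ t :* (N :* (con 1 :* e))) refl t N _

  -- The inverses u and v divide `F≈gaps` by t (1 + t), and w inverts c = 1 - t² as `top-scales` and
  -- `centre-expands` require. The products with u and v have the shape to which the quotients of
  -- the theorem unfold.
  F-expansion : ∀ y t u v w → u * (1# + t) ≈ 1# → v * t ≈ 1# → w * (1# - t ^ 2) ≈ 1# → ∀ n →
    F (suc n) y t ≈ (1# * u) * (((1# + y) ^ suc n * v) * A (suc n) (t ^ 2)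
      + ∑[ k ≤ suc n ] ((suc n C toℕ k) · ((1# + y) ^ toℕ k * (1# - t ^ 2) ^ (suc n ∸ toℕ k) * A (toℕ k) (t ^ 2))))
  F-expansion y t u v w u*[1+t]≈1 v*t≈1 w*c≈1 m = begin
    F n y t
      ≈⟨ solve 1 (λ f → f := con 1 :* (con 1 :* f)) refl (F n y t) ⟩
    1# * (1# * F n y t)
      ≈⟨ *-cong u*[1+t]≈1 (*-congʳ v*t≈1) ⟨
    u * (1# + t) * (v * t * F n y t)
      ≈⟨ solve 4 (λ u v t f → u :* (con 1 :+ t) :* (v :* t :* f) := u :* (v :* (t :* (con 1 :+ t) :* f))) refl
         u v t (F n y t) ⟩
    u * (v * (t * (1# + t) * F n y t))
      ≈⟨ *-congˡ (*-congˡ (F≈gaps m y t)) ⟩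
    u * (v * (G n (false , n) + t * G n (false , 0)))
      ≈⟨ solve 5 (λ u v t p q → u :* (v :* (p :+ t :* q)) := u :* (v :* p :+ v :* t :* q)) refl
         u v t (G n (false , n)) (G n (false , 0)) ⟩
    u * (v * G n (false , n) + v * t * G n (false , 0))
      ≈⟨ *-congˡ (+-cong (*-congˡ top) (trans (*-cong v*t≈1 centre) (*-identityˡ _))) ⟩
    u * (v * ((1# + y) ^ n * A n x) + S)
      ≈⟨ solve 5 (λ u v r p s → u :* (v :* (r :* p) :+ s) := (con 1 :* u) :* ((r :* v) :* p :+ s)) refl
         u v ((1# + y) ^ n) (A n x) S ⟩
    (1# * u) * (((1# + y) ^ n * v) * A n x + S) ∎
    where
    n = suc m
    x = t ^ 2
    c = 1# - x
    G = gapSum y x both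
    S = ∑[ k ≤ n ] ((n C toℕ k) · ((1# + y) ^ toℕ k * c ^ (n ∸ toℕ k) * A (toℕ k) x))

    x+c≈1 : x + c ≈ 1#
    x+c≈1 = begin
      x + (1# + - x)  ≈⟨ solve 2 (λ x x′ → x :+ (con 1 :+ x′) := con 1 :+ (x :+ x′)) refl x (- x) ⟩
      1# + (x + - x)  ≈⟨ +-congˡ (-‿inverseʳ x) ⟩
      1# + 0#         ≈⟨ +-identityʳ 1# ⟩
      1#              ∎

    top : G n (false , n) ≈ (1# + y) ^ n * A n x
    top = trans (top-scales x+c≈1 w*c≈1 (both-gaps y x) (positive-gaps y x) n)
                (*-congˡ (sym (A≈top y x n)))

    centre : G n (false , 0) ≈ S
    centre = trans (centre-expands x+c≈1 w*c≈1 (both-gaps y x) (positive-gaps y x) n)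
      (sum-cong-≋ {suc n} λ k → ×-congʳ (n C toℕ k)
        (*-congˡ {(1# + y) ^ toℕ k * c ^ (n ∸ toℕ k)} (sym (A≈top y x (toℕ k)))))

-- Reciprocals of fractions

module Reciprocals {a ℓ} (D : IntegralDomain a ℓ) where
  open Fractions D
  private module D = IntegralDomain D

  -- Exactly the factor by which `_/_⟨_⟩` multiplies.
  reciprocal : ∀ d → ¬ d ≃ 0ᶠ → Fraction
  reciprocal d d≄0 = mkFrac (den d) (num d) (num≉0 d≄0)

  reciprocal-inverseˡ : ∀ d (d≄0 : ¬ d ≃ 0ᶠ) → reciprocal d d≄0 *ᶠ d ≃ 1ᶠ
  reciprocal-inverseˡ d d≄0 =
    mk≃ (D.trans (D.*-identityʳ _) (D.trans (D.*-comm _ _) (D.sym (D.*-identityˡ _))))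

-- The identity over ℤ(y,t)

open import Defs

open Reciprocals ℤ[y,t].polynomials

-- Comparing the coefficients constant in both t and y would give 1 = 0 in ℤ.
1-t²≉0 : ¬ 1# - t ^ 2 ≈ 0#
1-t²≉0 e = contradiction (ℤ[y].at (ℤ[y,t].at (ℤ⟨y,t⟩.cross e) 0) 0) λ ()

theorem2p8 : ∀ (n : ℕ) .{{_ : NonZero n}} →
    F n y t ≈ (1# / (1# + t) ⟨ 1+t≉0 ⟩)
    * (((1# + y) ^ n / t ⟨ t≉0 ⟩) * A n (t ^ 2)
    + (∑[ k ≤ n ] ((n C toℕ k) × ((1# + y) ^ toℕ k * (1# - t ^ 2) ^ (n ∸ toℕ k) * A (toℕ k) (t ^ 2)))))
-- The quotients are by definition products with `reciprocal`, so the general expansion has the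
-- required type.
theorem2p8 (suc n) = Enumeration.F-expansion fractions y t
  (reciprocal (1# + t) 1+t≉0) (reciprocal t t≉0) (reciprocal (1# - t ^ 2) 1-t²≉0)
  (reciprocal-inverseˡ (1# + t) 1+t≉0) (reciprocal-inverseˡ t t≉0)
  (reciprocal-inverseˡ (1# - t ^ 2) 1-t²≉0) n
  where open ℤ⟨y,t⟩ using (fractions)
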